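{- Assume there is an oracle $\mathcal{O}$ which, given any nonsingular $B'\in\mathbb{Z}^{n\times n}$, returns $\lambda_1(L(B'))$ (optimization SVP). Then there is an algorithm which, given any nonsingular $B\in\mathbb{Z}^{n\times n}$, outputs a vector $v\in L(B)$ with $\|v\|=\lambda_1(L(B))$ (search SVP), making exactly one call to $\mathcal{O}$ (on a nonsingular integer $n\times n$ matrix), and running in time polynomial in $\log_2 M$, $n$ and $\log_2 n$, where $M=\max_{i,j}|b_{ij}|$ is the largest absolute value of an entry of $B$.
   Context: For a nonsingular $B\in\mathbb{R}^{n\times n}$ with columns $b_1,\dots,b_n$, the lattice is $L(B)=\{\sum_{i=1}^n x_ib_i : x_i\in\mathbb{Z}\}$ and $\lambda_1(L(B))$ is the Euclidean length of a shortest nonzero vector of $L(B)$. Oracle calls are counted as unit cost. -}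

module Defs where

open import Data.Bool.Base using (if_then_else_)
open import Data.Fin.Base using (Fin; zero; suc; toℕ; fromℕ<; combine; punchIn)
open import Data.Integer.Base as ℤ using (ℤ; +_; +[1+_]; -[1+_]; 0ℤ; 1ℤ; -1ℤ; ∣_∣)
import Data.Integer.Properties as ℤ
open import Data.List.Base using (List; []; _∷_; _++_)
open import Data.Nat.Base as ℕ using (ℕ; zero; suc; _⊔_)
open import Data.Nat.Logarithm using (⌊log₂_⌋)
import Data.Nat.Properties as ℕ
open import Data.Product.Base using (Σ-syntax; _×_)
open import Data.Vec.Functional using (Vector; foldr; concat)
open import Relation.Binary.Definitions using (DecidableEquality)
open import Relation.Binary.PropositionalEquality.Core using (_≡_)
open import Relation.Nullary.Decidable.Core using (does; yes; no)
open import Relation.Nullary.Negation.Core using (¬_)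

open import Algebra.Properties.CommutativeMonoid.Sum ℤ.+-0-commutativeMonoid
  public using (sum)

------------------------------------------------------------------------
-- Integer matrices and lattices

-- `B i j` is the entry in row `i` and column `j`; the basis vector bⱼ is
-- the column `λ i → B i j`.
Matrix : ℕ → Set
Matrix n = Vector (Vector ℤ n) n

det : ∀ {n} → Matrix n → ℤ
det {zero}  A = 1ℤ
det {suc n} A =
  sum λ j → (-1ℤ ℤ.^ toℕ j) ℤ.* A zero j ℤ.* det (λ i k → A (suc i) (punchIn j k))

Nonsingular : ∀ {n} → Matrix n → Set
Nonsingular B = ¬ (det B ≡ 0ℤ)

maxAbs : ∀ {n} → Matrix n → ℕ
maxAbs B = foldr _⊔_ 0 λ i → foldr _⊔_ 0 λ j → ∣ B i j ∣

infix 4 _∈L_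

_∈L_ : ∀ {n} → Vector ℤ n → Matrix n → Set
_∈L_ {n} v B = Σ[ x ∈ Vector ℤ n ] ∀ i → v i ≡ sum λ j → x j ℤ.* B i j

Nonzero : ∀ {n} → Vector ℤ n → Set
Nonzero v = ¬ (∀ i → v i ≡ 0ℤ)

∥_∥² : ∀ {n} → Vector ℤ n → ℤ
∥ v ∥² = sum λ i → v i ℤ.* v i

-- `k` is λ₁(L(B))².  Lengths of integer vectors are square roots of
-- natural numbers, and are represented throughout by their squares.
Isλ₁² : ∀ {n} → Matrix n → ℤ → Set
Isλ₁² {n} B k =
  (Σ[ v ∈ Vector ℤ n ] v ∈L B × Nonzero v × ∥ v ∥² ≡ k) ×
  (∀ w → w ∈L B → Nonzero w → k ℤ.≤ ∥ w ∥²)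

Oracle : ℕ → Set
Oracle n = Matrix n → ℤ

-- Nothing is assumed about the answers to singular matrices.
OptimizationSVP : ∀ {n} → Oracle n → Set
OptimizationSVP O = ∀ B → Nonsingular B → Isλ₁² B (O B)

------------------------------------------------------------------------
-- Oracle programs: a random-access machine with structured control flow
-- and logarithmic costs.  The store has integer variables and integer
-- arrays, both named by natural numbers; array indices are integers.

data Op : Set where
  add sub mul div : Op

data Expr : Set where
  con : ℤ → Expr
  var : ℕ → Expr
  get : ℕ → Expr → Expr
  bin : Op → Expr → Expr → Expr

infix  6 _≔_ _[_]≔_
infixr 5 _⨾_

data Program : Set where
  skip           : Program
  _≔_            : ℕ → Expr → Program
  _[_]≔_         : ℕ → Expr → Expr → Program
  _⨾_            : Program → Program → Program
  -- The guards of `if⁺` and `while⁺` test for a positive value.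
  if⁺_then_else_ : Expr → Program → Program → Program
  while⁺_loop_   : Expr → Program → Program
  -- `x ≔query a` submits the matrix in array `a` and stores the answer
  -- in variable `x`.
  _≔query_       : ℕ → ℕ → Program

record State : Set where
  constructor ⟨_,_⟩
  field
    vars : ℕ → ℤ
    arrs : ℕ → ℤ → ℤ

open State public

update : ∀ {A B : Set} → DecidableEquality A → (A → B) → A → B → A → B
update _≟_ f x y z = if does (z ≟ x) then y else f z

setVar : State → ℕ → ℤ → State
setVar σ x z = ⟨ update ℕ._≟_ (vars σ) x z , arrs σ ⟩

setArr : State → ℕ → ℤ → ℤ → State
setArr σ a i z =
  ⟨ vars σ , update ℕ._≟_ (arrs σ) a (update ℤ._≟_ (arrs σ a) i z) ⟩

-- Euclidean division, with division by 0 yielding 0.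
_÷_ : ℤ → ℤ → ℤ
i ÷ (+ 0)        = 0ℤ
i ÷ j@(+[1+ _ ]) = i ℤ./ j
i ÷ j@(-[1+ _ ]) = i ℤ./ j

apply : Op → ℤ → ℤ → ℤ
apply add = ℤ._+_
apply sub = ℤ._-_
apply mul = ℤ._*_
apply div = _÷_

⟦_⟧ : Expr → State → ℤ
⟦ con z ⟧     σ = z
⟦ var x ⟧     σ = vars σ x
⟦ get a e ⟧   σ = arrs σ a (⟦ e ⟧ σ)
⟦ bin o e f ⟧ σ = apply o (⟦ e ⟧ σ) (⟦ f ⟧ σ)

bits : ℤ → ℕ
bits z = suc ⌊log₂ ∣ z ∣ ⌋

-- The bit cost of a single arithmetic operation, that of the schoolbook
-- algorithms.
opCost : Op → ℤ → ℤ → ℕ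
opCost add y z = bits y ℕ.+ bits z
opCost sub y z = bits y ℕ.+ bits z
opCost mul y z = bits y ℕ.* bits z
opCost div y z = bits y ℕ.* bits z

cost : Expr → State → ℕ
cost (con z)     σ = bits z
cost (var x)     σ = bits (vars σ x)
cost (get a e)   σ = cost e σ ℕ.+ bits (⟦ e ⟧ σ) ℕ.+ bits (⟦ get a e ⟧ σ)
cost (bin o e f) σ = cost e σ ℕ.+ cost f σ ℕ.+ opCost o (⟦ e ⟧ σ) (⟦ f ⟧ σ)

-- Matrices are stored in row-major order: `toℕ (combine i j)` is
-- `n * toℕ i + toℕ j`.
readMatrix : ∀ {n} → State → ℕ → Matrix n
readMatrix σ a i j = arrs σ a (+ toℕ (combine i j))

-- `O ⊢ P , σ ⇓ σ′ ∣ t ∣ qs`: with oracle `O`, program `P` started in `σ`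
-- halts in `σ′` after time `t`, having submitted exactly the queries `qs`.
infix 3 _⊢_,_⇓_∣_∣_

data _⊢_,_⇓_∣_∣_ {n} (O : Oracle n)
     : Program → State → State → ℕ → List (Matrix n) → Set where

  skip⇓ : ∀ {σ} → O ⊢ skip , σ ⇓ σ ∣ 1 ∣ []

  assign⇓ : ∀ {σ x e} →
    O ⊢ x ≔ e , σ ⇓ setVar σ x (⟦ e ⟧ σ) ∣ suc (cost e σ ℕ.+ bits (⟦ e ⟧ σ)) ∣ []

  store⇓ : ∀ {σ a e f} →
    O ⊢ a [ e ]≔ f , σ ⇓ setArr σ a (⟦ e ⟧ σ) (⟦ f ⟧ σ)
      ∣ suc (cost e σ ℕ.+ cost f σ ℕ.+ bits (⟦ e ⟧ σ) ℕ.+ bits (⟦ f ⟧ σ)) ∣ []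

  seq⇓ : ∀ {P Q σ σ′ σ″ s t ps qs} →
    O ⊢ P , σ ⇓ σ′ ∣ s ∣ ps →
    O ⊢ Q , σ′ ⇓ σ″ ∣ t ∣ qs →
    O ⊢ P ⨾ Q , σ ⇓ σ″ ∣ s ℕ.+ t ∣ ps ++ qs

  then⇓ : ∀ {e P Q σ σ′ t qs} →
    0ℤ ℤ.< ⟦ e ⟧ σ →
    O ⊢ P , σ ⇓ σ′ ∣ t ∣ qs →
    O ⊢ if⁺ e then P else Q , σ ⇓ σ′ ∣ suc (cost e σ ℕ.+ t) ∣ qs

  else⇓ : ∀ {e P Q σ σ′ t qs} →
    ⟦ e ⟧ σ ℤ.≤ 0ℤ →
    O ⊢ Q , σ ⇓ σ′ ∣ t ∣ qs →
    O ⊢ if⁺ e then P else Q , σ ⇓ σ′ ∣ suc (cost e σ ℕ.+ t) ∣ qs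

  exit⇓ : ∀ {e P σ} →
    ⟦ e ⟧ σ ℤ.≤ 0ℤ →
    O ⊢ while⁺ e loop P , σ ⇓ σ ∣ suc (cost e σ) ∣ []

  loop⇓ : ∀ {e P σ σ′ σ″ s t ps qs} →
    0ℤ ℤ.< ⟦ e ⟧ σ →
    O ⊢ P , σ ⇓ σ′ ∣ s ∣ ps →
    O ⊢ while⁺ e loop P , σ′ ⇓ σ″ ∣ t ∣ qs →
    O ⊢ while⁺ e loop P , σ ⇓ σ″ ∣ suc (cost e σ ℕ.+ s ℕ.+ t) ∣ ps ++ qs

  -- A call has unit cost.
  query⇓ : ∀ {σ x a} →
    O ⊢ x ≔query a , σ ⇓ setVar σ x (O (readMatrix σ a)) ∣ 1
      ∣ readMatrix σ a ∷ []

-- The input: `n` is in variable 0 and `B` in array 0, row-major; every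
-- other variable and array entry is 0.
initial : ∀ {n} → Matrix n → State
initial {n} B = ⟨ vs , as ⟩
  where
  vs : ℕ → ℤ
  vs 0       = + n
  vs (suc _) = 0ℤ

  as : ℕ → ℤ → ℤ
  as 0 (+ k) with k ℕ.<? n ℕ.* n
  ... | yes k<n² = concat B (fromℕ< k<n²)
  ... | no  _    = 0ℤ
  as _ _ = 0ℤ

-- The output is read off array 1.
output : ∀ {n} → State → Vector ℤ n
output σ i = arrs σ 1 (+ toℕ i)

------------------------------------------------------------------------
-- Polynomials in k variables with natural number coefficients

data Polynomial (k : ℕ) : Set where
  const   : ℕ → Polynomial k
  X       : Fin k → Polynomial k
  _⊕_ _⊗_ : Polynomial k → Polynomial k → Polynomial k

eval : ∀ {k} → Polynomial k → Vector ℕ k → ℕ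
eval (const c) ρ = c
eval (X i)     ρ = ρ i
eval (p ⊕ q)   ρ = eval p ρ ℕ.+ eval q ρ
eval (p ⊗ q)   ρ = eval p ρ ℕ.* eval q ρ

{-# OPTIONS --safe #-}
-- Let ℓ(v) = Σᵢ vᵢ Dⁱ, and let B′ be K B with ℓ of the j-th column of B added to the
-- entry in row 0 and column j.  For v = B x and w = B′ x,
--
--   ∥w∥² = K² ∥v∥² + 2 K v₀ ℓ(v) + ℓ(v)².
--
-- If K is large compared with D ^ n, the first term dominates, so a shortest w ∈ L(B′)
-- comes from a shortest v ∈ L(B); moreover ℓ(v)² < K is the remainder of
-- λ₁(L(B′))² modulo K.  If D > 2 λ₁(L(B))², the entries of ± v are the signed base D
-- digits of the square root of that remainder.  Expanding det B′ along row 0 gives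
-- Kⁿ⁻¹ (K det B + δ) with ∣ δ ∣ < K, so B′ is nonsingular.
--
-- For the running time it suffices to count steps and to exhibit one β such that every
-- number in the store stays below 2 ^ β, as each step then costs O(β²).
module Submission where

open import Defs
open import Data.Bool.Base using (true; false)
open import Data.Fin.Base as Fin using (Fin; zero; suc; toℕ; fromℕ<; combine; punchIn)
import Data.Fin.Properties as Fin
open import Data.Integer.Base as ℤ using (ℤ; +_; +[1+_]; -[1+_]; 0ℤ; 1ℤ; -1ℤ; ∣_∣)
import Data.Integer.DivMod as ℤ
import Data.Integer.Properties as ℤ
import Data.Integer.Tactic.RingSolver as ℤSolver
open import Data.List.Base using ([]; _∷_)
open import Data.Nat.Base
open import Data.Nat.DivMod using (m/n≤m; m≡m%n+[m/n]*n; m%n<n)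
open import Data.Nat.Logarithm using (⌊log₂_⌋; ⌊log₂⌋-mono-≤; ⌊log₂[2^n]⌋≡n)
open import Data.Nat.Properties
import Data.Nat.Tactic.RingSolver as ℕSolver
open import Data.Product.Base using (Σ-syntax; ∃-syntax; _×_; _,_; proj₁; proj₂)
open import Data.Sum.Base using (_⊎_; inj₁; inj₂; [_,_]′)
import Data.Vec.Functional as Vector
open import Data.Vec.Functional using (Vector)
open import Function.Base using (_∘_)
open import Relation.Binary.PropositionalEquality
open import Relation.Nullary.Decidable.Core using (Dec; does; yes; no; ¬?)
open import Relation.Nullary.Decidable using (decidable-stable)
open import Relation.Nullary.Negation.Core using (¬_; contradiction)
open import Algebra.Properties.Semiring.Sum ℤ.+-*-semiring
  using (sum-cong-≗; sum-replicate-zero; ∑-distrib-+; *-distribˡ-sum)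
open ≤-Reasoning
private module ≤R = ℤ.≤-Reasoning

-- Running times

-- One answer has to carry all coordinates of a vector, so they are packed into the single integer
-- ℓ(v). The cross term 2 K v₀ ℓ(v) is harmless for decoding, being a multiple of K, but it
-- threatens the comparison of lengths, where no bound on v is known in advance. It is tamed by v₀
-- ℓ(v) = ℓ(v₀ v): the coordinates of v₀ v are at most ∥v∥² in absolute value, so the term is linear
-- in ∥v∥². Squared lengths are integers, so two different ones differ by at least K² after scaling,
-- against errors of order K.
--
-- The scales: U is n plus the sum of all squared entries, which needs neither absolute values nor
-- maxima. A column of B shows λ₁² ≤ n U² ≤ U³ = G. The coordinates of a shortest v then lie in -G,
-- ..., G, which are exactly the digits for D = 2 G + 1. With Q = Dⁿ and E = Q G one has ∣ℓ(v)∣ ≤ E.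
-- Finally K = 8 E² exceeds both E², which makes ℓ(v)² a remainder, and 7 E, which the comparison of
-- lengths requires.

∣/ℕ∣≤ : ∀ i d .{{_ : NonZero d}} → ∣ i ℤ./ℕ d ∣ ≤ ∣ i ∣
∣/ℕ∣≤ (+ m) d = m/n≤m m d
∣/ℕ∣≤ -[1+ m ] d with suc m % d in eq
... | zero = subst (_≤ suc m) (sym (ℤ.∣-i∣≡∣i∣ (+ (suc m / d)))) (m/n≤m (suc m) d)
-- Rounding a negative quotient down adds one to its absolute value; the nonzero remainder `suc r`
-- pays for it.
... | suc r = begin
  suc (suc m / d)             ≤⟨ s≤s (m≤m*n (suc m / d) d) ⟩
  suc (suc m / d * d)         ≤⟨ s≤s (m≤n+m _ r) ⟩
  suc r + suc m / d * d       ≡⟨ cong (_+ suc m / d * d) eq ⟨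
  suc m % d + suc m / d * d   ≡⟨ m≡m%n+[m/n]*n (suc m) d ⟨
  suc m                       ∎

∣÷∣≤ : ∀ i j → ∣ i ÷ j ∣ ≤ ∣ i ∣
∣÷∣≤ i (+ 0) = z≤n
∣÷∣≤ i +[1+ d ] =
  subst (_≤ ∣ i ∣) (cong ∣_∣ (sym (ℤ.div-pos-is-/ℕ i (suc d)))) (∣/ℕ∣≤ i (suc d))
∣÷∣≤ i -[1+ d ] = subst (_≤ ∣ i ∣)
  (trans (sym (ℤ.∣-i∣≡∣i∣ (i ℤ./ℕ suc d))) (cong ∣_∣ (sym (ℤ.div-neg-is-neg-/ℕ i (suc d)))))
  (∣/ℕ∣≤ i (suc d))

n<2^[1+⌊log₂n⌋] : ∀ n → n < 2 ^ suc ⌊log₂ n ⌋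
n<2^[1+⌊log₂n⌋] n = ≰⇒> λ 2^≤n → n≮n ⌊log₂ n ⌋
  (subst (_≤ ⌊log₂ n ⌋) (⌊log₂[2^n]⌋≡n (suc ⌊log₂ n ⌋)) (⌊log₂⌋-mono-≤ 2^≤n))

bits≤ : ∀ {z p} → ∣ z ∣ ≤ 2 ^ p → bits z ≤ suc p
bits≤ {z} {p} z≤ = s≤s (subst (⌊log₂ ∣ z ∣ ⌋ ≤_) (⌊log₂[2^n]⌋≡n p) (⌊log₂⌋-mono-≤ z≤))

-- Lets sums and differences share the bound for products, so that `size` need not distinguish the
-- operations.
m+n≤m*n : ∀ {m n} → 2 ≤ m → 2 ≤ n → m + n ≤ m * n
m+n≤m*n {suc (suc m)} {suc (suc n)} _ _ = begin
  2 + m + (2 + n)                    ≤⟨ m≤m+n _ (m + n + m * n) ⟩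
  2 + m + (2 + n) + (m + n + m * n)  ≡⟨ expand m n ⟩
  (2 + m) * (2 + n)                  ∎
  where
  expand : ∀ m n → 2 + m + (2 + n) + (m + n + m * n) ≡ (2 + m) * (2 + n)
  expand = ℕSolver.solve-∀
m+n≤m*n {1} (s≤s ())
m+n≤m*n {suc (suc m)} {1} _ (s≤s ())

record Bounded (β : ℕ) (σ : State) : Set where
  constructor bounds
  field
    ∣vars∣≤ : ∀ x → ∣ vars σ x ∣ ≤ 2 ^ β
    ∣arrs∣≤ : ∀ a i → ∣ arrs σ a i ∣ ≤ 2 ^ β

open Bounded

setVar-bounded : ∀ {β σ z} x → Bounded β σ → ∣ z ∣ ≤ 2 ^ β → Bounded β (setVar σ x z)
setVar-bounded {β} {σ} {z} x (bounds vs≤ as≤) z≤ = bounds vs′≤ as≤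
  where
  vs′≤ : ∀ y → ∣ vars (setVar σ x z) y ∣ ≤ 2 ^ β
  vs′≤ y with y ≡ᵇ x
  ... | true  = z≤
  ... | false = vs≤ y

-- In a `β`-bounded state the value of `e` has at most `size e * β` bits.
size : Expr → ℕ
size (con z)     = bits z
size (var x)     = 1
size (get a e)   = suc (size e)
size (bin o e f) = size e + size f

-- Bounds the cost in units of `unit β`. In the last clause `size e + size f` covers the linear
-- operations and `size e * size f` the quadratic ones.
weight : Expr → ℕ
weight (con z)     = bits z
weight (var x)     = 1
weight (get a e)   = suc (weight e + size e)
weight (bin o e f) = weight e + weight f + (size e + size f + size e * size f)

1≤size : ∀ e → 1 ≤ size e
1≤size (con z)     = s≤s z≤n
1≤size (var x)     = s≤s z≤n
1≤size (get a e)   = s≤s z≤n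
1≤size (bin o e f) = ≤-trans (1≤size e) (m≤m+n _ _)

setArr-bounded : ∀ {β σ z} a i → Bounded β σ → ∣ z ∣ ≤ 2 ^ β → Bounded β (setArr σ a i z)
setArr-bounded {β} {σ} {z} a i (bounds vs≤ as≤) z≤ = bounds vs≤ as′≤
  where
  as′≤ : ∀ b j → ∣ arrs (setArr σ a i z) b j ∣ ≤ 2 ^ β
  as′≤ b j with b ≡ᵇ a
  ... | false = as≤ b j
  ... | true with does (j ℤ.≟ i)
  ...   | false = as≤ a j
  ...   | true  = z≤

∣⟦⟧∣≤ : ∀ {β σ} → 1 ≤ β → Bounded β σ → ∀ e → ∣ ⟦ e ⟧ σ ∣ ≤ 2 ^ (size e * β)
∣⟦⟧∣≤ {β} {σ} 1≤β bd (con z) = ≤-trans (<⇒≤ (n<2^[1+⌊log₂n⌋] ∣ z ∣))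
  (^-monoʳ-≤ 2 (subst (_≤ bits z * β) (*-identityʳ (bits z)) (*-monoʳ-≤ (bits z) 1≤β)))
∣⟦⟧∣≤ {β} {σ} 1≤β bd (var x) =
  subst (λ p → ∣ vars σ x ∣ ≤ 2 ^ p) (sym (*-identityˡ β)) (∣vars∣≤ bd x)
∣⟦⟧∣≤ {β} {σ} 1≤β bd (get a e) =
  ≤-trans (∣arrs∣≤ bd a (⟦ e ⟧ σ)) (^-monoʳ-≤ 2 (m≤m+n β (size e * β)))
∣⟦⟧∣≤ {β} {σ} 1≤β bd (bin o e f) = ∣apply∣≤ o
  where
  p = size e * β
  q = size f * β

  2≤2^ : ∀ e → 2 ≤ 2 ^ (size e * β)
  2≤2^ e = ^-monoʳ-≤ 2 {1} (*-mono-≤ (1≤size e) 1≤β)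

  product : 2 ^ p * 2 ^ q ≡ 2 ^ ((size e + size f) * β)
  product = trans (sym (^-distribˡ-+-* 2 p q)) (cong (2 ^_) (sym (*-distribʳ-+ β (size e) (size f))))

  ∣+∣≤ : ∣ ⟦ e ⟧ σ ∣ + ∣ ⟦ f ⟧ σ ∣ ≤ 2 ^ ((size e + size f) * β)
  ∣+∣≤ = subst (_ ≤_) product
    (≤-trans (+-mono-≤ (∣⟦⟧∣≤ 1≤β bd e) (∣⟦⟧∣≤ 1≤β bd f)) (m+n≤m*n (2≤2^ e) (2≤2^ f)))

  ∣apply∣≤ : ∀ o → ∣ apply o (⟦ e ⟧ σ) (⟦ f ⟧ σ) ∣ ≤ 2 ^ ((size e + size f) * β)
  ∣apply∣≤ add = ≤-trans (ℤ.∣i+j∣≤∣i∣+∣j∣ (⟦ e ⟧ σ) (⟦ f ⟧ σ)) ∣+∣≤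
  ∣apply∣≤ sub = ≤-trans (ℤ.∣i-j∣≤∣i∣+∣j∣ (⟦ e ⟧ σ) (⟦ f ⟧ σ)) ∣+∣≤
  ∣apply∣≤ mul = subst₂ _≤_ (sym (ℤ.∣i*j∣≡∣i∣*∣j∣ (⟦ e ⟧ σ) (⟦ f ⟧ σ))) product
    (*-mono-≤ (∣⟦⟧∣≤ 1≤β bd e) (∣⟦⟧∣≤ 1≤β bd f))
  ∣apply∣≤ div = ≤-trans (∣÷∣≤ (⟦ e ⟧ σ) (⟦ f ⟧ σ)) (≤-trans (m≤m+n _ _) ∣+∣≤)

opCost≤ : ∀ o y z {b s t} → bits y ≤ s * suc b → bits z ≤ t * suc b →
          opCost o y z ≤ (s + t + s * t) * (suc b * suc b)
opCost≤ o y z {b} {s} {t} y≤ z≤ = by-cases o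
  where
  sum≤ : bits y + bits z ≤ (s + t + s * t) * (suc b * suc b)
  sum≤ = begin
    bits y + bits z                       ≤⟨ +-mono-≤ y≤ z≤ ⟩
    s * suc b + t * suc b                 ≡⟨ *-distribʳ-+ (suc b) s t ⟨
    (s + t) * suc b                       ≤⟨ *-mono-≤ (m≤m+n (s + t) (s * t)) (m≤m*n (suc b) (suc b)) ⟩
    (s + t + s * t) * (suc b * suc b)     ∎

  prod≤ : bits y * bits z ≤ (s + t + s * t) * (suc b * suc b)
  prod≤ = begin
    bits y * bits z                       ≤⟨ *-mono-≤ y≤ z≤ ⟩
    s * suc b * (t * suc b)               ≡⟨ [m*n]*[o*p]≡[m*o]*[n*p] s (suc b) t (suc b) ⟩
    s * t * (suc b * suc b)               ≤⟨ *-monoˡ-≤ (suc b * suc b) (m≤n+m (s * t) (s + t)) ⟩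
    (s + t + s * t) * (suc b * suc b)     ∎

  by-cases : ∀ o → opCost o y z ≤ (s + t + s * t) * (suc b * suc b)
  by-cases add = sum≤
  by-cases sub = sum≤
  by-cases mul = prod≤
  by-cases div = prod≤

-- Numbers up to `2 ^ β` have at most `suc β` bits; this is the schoolbook cost of multiplying two
-- of them.
unit : ℕ → ℕ
unit β = suc β * suc β

-- In units of `unit β`; a loop is charged for a single iteration.
stepTime : Program → ℕ
stepTime skip                   = 1
stepTime (x ≔ e)                = suc (weight e + size e)
stepTime (a [ e ]≔ f)           = suc (weight e + weight f + size e + size f)
stepTime (P ⨾ Q)                = stepTime P + stepTime Q
stepTime (if⁺ e then P else Q)  = suc (weight e + (stepTime P + stepTime Q))
stepTime (while⁺ e loop P)      = suc (weight e + stepTime P)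
stepTime (x ≔query a)           = 1

-- Running programs that do not call the oracle

module Run {n} (O : Oracle n) {β} (1≤β : 1 ≤ β) where

  bits≤size : ∀ {σ} → Bounded β σ → ∀ e → bits (⟦ e ⟧ σ) ≤ size e * suc β
  bits≤size {σ} bd e = begin
    bits (⟦ e ⟧ σ)          ≤⟨ bits≤ {⟦ e ⟧ σ} (∣⟦⟧∣≤ 1≤β bd e) ⟩
    suc (size e * β)        ≤⟨ +-monoˡ-≤ (size e * β) (1≤size e) ⟩
    size e + size e * β     ≡⟨ *-suc (size e) β ⟨
    size e * suc β          ∎

  suc-β≤unit : suc β ≤ unit β
  suc-β≤unit = m≤m*n (suc β) (suc β)

  bits≤unit : ∀ {σ} → Bounded β σ → ∀ e → bits (⟦ e ⟧ σ) ≤ size e * unit β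
  bits≤unit bd e = ≤-trans (bits≤size bd e) (*-monoʳ-≤ (size e) suc-β≤unit)

  cost≤ : ∀ {σ} → Bounded β σ → ∀ e → cost e σ ≤ weight e * unit β
  cost≤ bd (con z) = m≤m*n (bits z) (unit β)
  cost≤ {σ} bd (var x) = bits≤unit bd (var x)
  cost≤ {σ} bd (get a e) = begin
    cost e σ + bits (⟦ e ⟧ σ) + bits (⟦ get a e ⟧ σ)
      ≤⟨ +-mono-≤ (+-mono-≤ (cost≤ bd e) (bits≤unit bd e))
                  (≤-trans (bits≤ {⟦ get a e ⟧ σ} (∣arrs∣≤ bd a (⟦ e ⟧ σ))) suc-β≤unit) ⟩
    weight e * unit β + size e * unit β + unit β
      ≡⟨ collect (weight e) (size e) (unit β) ⟩
    suc (weight e + size e) * unit β  ∎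
    where
    collect : ∀ w s u → w * u + s * u + u ≡ suc (w + s) * u
    collect = ℕSolver.solve-∀
  cost≤ {σ} bd (bin o e f) = begin
    cost e σ + cost f σ + opCost o (⟦ e ⟧ σ) (⟦ f ⟧ σ)
      ≤⟨ +-mono-≤ (+-mono-≤ (cost≤ bd e) (cost≤ bd f))
                  (opCost≤ o (⟦ e ⟧ σ) (⟦ f ⟧ σ) {s = size e} (bits≤size bd e) (bits≤size bd f)) ⟩
    weight e * unit β + weight f * unit β + s * unit β
      ≡⟨ collect (weight e) (weight f) s (unit β) ⟩
    (weight e + weight f + s) * unit β  ∎
    where
    s = size e + size f + size e * size f
    collect : ∀ w v s u → w * u + v * u + s * u ≡ (w + v + s) * u
    collect = ℕSolver.solve-∀

  -- A total-correctness triple with a clock. Boundedness of the final state is part of it because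
  -- the cost estimate of the next program depends on it.
  record Runs (P : Program) (σ : State) (T : ℕ) (Φ : State → Set) : Set where
    constructor runs
    field
      {final}   : State
      {time}    : ℕ
      execution : O ⊢ P , σ ⇓ final ∣ time ∣ []
      time≤     : time ≤ T * unit β
      bounded   : Bounded β final
      holds     : Φ final

  weaken : ∀ {P σ T Φ Ψ} → Runs P σ T Φ → (∀ {σ′} → Φ σ′ → Ψ σ′) → Runs P σ T Ψ
  weaken (runs ex t≤ bd φ) f = runs ex t≤ bd (f φ)

  suc≤ : ∀ T {t} → t ≤ T * unit β → suc t ≤ suc T * unit β
  suc≤ T t≤ = +-mono-≤ {1} {unit β} (s≤s z≤n) t≤

  -- The postcondition determines the final state; after matching it with `refl`, lookups of all
  -- other variables compute, and no frame conditions arise.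
  assign : ∀ {σ x e} → Bounded β σ → ∣ ⟦ e ⟧ σ ∣ ≤ 2 ^ β →
           Runs (x ≔ e) σ (stepTime (x ≔ e)) (setVar σ x (⟦ e ⟧ σ) ≡_)
  assign {σ} {x} {e} bd e≤ = runs assign⇓
    (suc≤ (weight e + size e) (≤-trans (+-mono-≤ (cost≤ bd e) (bits≤unit bd e))
      (≤-reflexive (sym (*-distribʳ-+ (unit β) (weight e) (size e))))))
    (setVar-bounded {z = ⟦ e ⟧ σ} x bd e≤) refl

  store : ∀ {σ a e f} → Bounded β σ → ∣ ⟦ f ⟧ σ ∣ ≤ 2 ^ β →
          Runs (a [ e ]≔ f) σ (stepTime (a [ e ]≔ f)) (setArr σ a (⟦ e ⟧ σ) (⟦ f ⟧ σ) ≡_)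
  store {σ} {a} {e} {f} bd f≤ = runs store⇓
    (suc≤ (weight e + weight f + size e + size f) (≤-trans
      (+-mono-≤ (+-mono-≤ (+-mono-≤ (cost≤ bd e) (cost≤ bd f)) (bits≤unit bd e)) (bits≤unit bd f))
      (≤-reflexive (collect (weight e) (weight f) (size e) (size f) (unit β)))))
    (setArr-bounded {z = ⟦ f ⟧ σ} a (⟦ e ⟧ σ) bd f≤) refl
    where
    collect : ∀ a b c d u → a * u + b * u + c * u + d * u ≡ (a + b + c + d) * u
    collect = ℕSolver.solve-∀

  infixr 5 _andThen_

  _andThen_ : ∀ {P Q σ S T Φ Ψ} → Runs P σ S Φ →
              (∀ {σ′} → Bounded β σ′ → Φ σ′ → Runs Q σ′ T Ψ) →
              Runs (P ⨾ Q) σ (S + T) Ψ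
  _andThen_ {S = S} {T} (runs ex s≤ bd φ) f with f bd φ
  ... | runs ex′ t≤ bd′ ψ = runs (seq⇓ ex ex′)
    (≤-trans (+-mono-≤ s≤ t≤) (≤-reflexive (sym (*-distribʳ-+ (unit β) S T)))) bd′ ψ

  branch : ∀ {e P Q σ S T Φ} → Bounded β σ →
           (0ℤ ℤ.< ⟦ e ⟧ σ × Runs P σ S Φ) ⊎ (⟦ e ⟧ σ ℤ.≤ 0ℤ × Runs Q σ T Φ) →
           Runs (if⁺ e then P else Q) σ (suc (weight e + (S + T))) Φ
  branch {e} {σ = σ} {S = S} {T} bd (inj₁ (0<e , runs ex s≤ bd′ φ)) = runs (then⇓ 0<e ex)
    (suc≤ (weight e + (S + T)) (≤-trans
      (+-mono-≤ (cost≤ bd e) (≤-trans s≤ (*-monoˡ-≤ (unit β) (m≤m+n S T))))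
      (≤-reflexive (sym (*-distribʳ-+ (unit β) (weight e) (S + T)))))) bd′ φ
  branch {e} {σ = σ} {S = S} {T} bd (inj₂ (e≤0 , runs ex t≤ bd′ φ)) = runs (else⇓ e≤0 ex)
    (suc≤ (weight e + (S + T)) (≤-trans
      (+-mono-≤ (cost≤ bd e) (≤-trans t≤ (*-monoˡ-≤ (unit β) (m≤n+m T S))))
      (≤-reflexive (sym (*-distribʳ-+ (unit β) (weight e) (S + T)))))) bd′ φ

  -- The index of `Inv` is a variant. The loop may stop while it is still positive, as bisection
  -- does, where it only bounds the logarithm of the interval. The factor `suc j` also pays for the
  -- last, failing guard.
  iterate : ∀ {e P} (Inv : ℕ → State → Set) →
         (∀ {j σ} → Bounded β σ → Inv j σ → ⟦ e ⟧ σ ℤ.≤ 0ℤ ⊎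
           (0ℤ ℤ.< ⟦ e ⟧ σ × ∃[ i ] (j ≡ suc i × Runs P σ (stepTime P) (Inv i)))) →
         ∀ j {σ} → Bounded β σ → Inv j σ →
         Runs (while⁺ e loop P) σ (suc j * stepTime (while⁺ e loop P)) (λ σ′ → ⟦ e ⟧ σ′ ℤ.≤ 0ℤ × ∃[ i ] Inv i σ′)
  iterate {e} {P} Inv step j {σ} bd inv with step bd inv
  ... | inj₁ e≤0 = runs (exit⇓ e≤0)
    (≤-trans (suc≤ (weight e) (cost≤ bd e)) (*-monoˡ-≤ (unit β)
      (≤-trans (s≤s (m≤m+n (weight e) (stepTime P))) (m≤m+n _ (j * stepTime (while⁺ e loop P))))))
    bd (e≤0 , j , inv)
  ... | inj₂ (0<e , i , refl , runs ex s≤ bd′ inv′) with iterate {e} {P} Inv step i bd′ inv′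
  ...   | runs ex′ t≤ bd″ post = runs (loop⇓ 0<e ex ex′)
    (≤-trans (+-mono-≤ (+-mono-≤ {1} {unit β} (s≤s z≤n) (+-mono-≤ (cost≤ bd e) s≤)) t≤)
      (≤-reflexive (collect (weight e) T (suc i * suc (weight e + T)) (unit β))))
    bd″ post
    where
    T = stepTime P
    collect : ∀ w t r u → u + (w * u + t * u) + r * u ≡ (suc (w + t) + r) * u
    collect = ℕSolver.solve-∀

  countdown : ∀ {e P} (Inv : ℕ → State → Set) →
              (∀ {j σ} → Inv j σ → ⟦ e ⟧ σ ≡ + j) →
              (∀ {j σ} → Bounded β σ → Inv (suc j) σ → Runs P σ (stepTime P) (Inv j)) →
              ∀ j {σ} → Bounded β σ → Inv j σ →
              Runs (while⁺ e loop P) σ (suc j * stepTime (while⁺ e loop P)) (Inv 0)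
  countdown {e} {P} Inv guard step j bd inv = weaken (iterate {e} {P} Inv step′ j bd inv) exit
    where
    step′ : ∀ {j σ} → Bounded β σ → Inv j σ → ⟦ e ⟧ σ ℤ.≤ 0ℤ ⊎
            (0ℤ ℤ.< ⟦ e ⟧ σ × ∃[ i ] (j ≡ suc i × Runs P σ (stepTime P) (Inv i)))
    step′ {zero}  bd inv = inj₁ (ℤ.≤-reflexive (guard inv))
    step′ {suc j} bd inv =
      inj₂ (subst (0ℤ ℤ.<_) (sym (guard inv)) (ℤ.+<+ (s≤s z≤n)) , j , refl , step bd inv)

    exit : ∀ {σ′} → ⟦ e ⟧ σ′ ℤ.≤ 0ℤ × ∃[ i ] Inv i σ′ → Inv 0 σ′
    exit (e≤0 , zero  , inv) = inv
    exit (e≤0 , suc i , inv) with ℤ.+≤+ () ← subst (ℤ._≤ 0ℤ) (guard inv) e≤0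

-- Integer division

-- If `q < q′`, the left side lies below `(q + 1) d ≤ q′ d`. Two instances with the sides exchanged
-- make the quotient unique.
quotient-≤ : ∀ {d ρ ρ′} q q′ → ρ < d →
             + ρ ℤ.+ q ℤ.* + d ≡ + ρ′ ℤ.+ q′ ℤ.* + d → q′ ℤ.≤ q
quotient-≤ {d} {ρ} {ρ′} q q′ ρ<d eq = ℤ.≮⇒≥ λ q<q′ → ℤ.<-irrefl eq (≤R.begin-strict
  + ρ ℤ.+ q ℤ.* + d        ≤R.<⟨ ℤ.+-monoˡ-< (q ℤ.* + d) (ℤ.+<+ ρ<d) ⟩
  + d ℤ.+ q ℤ.* + d        ≤R.≡⟨ ℤ.suc-* q (+ d) ⟨
  ℤ.suc q ℤ.* + d          ≤R.≤⟨ ℤ.*-monoʳ-≤-nonNeg (+ d) (ℤ.i<j⇒suc[i]≤j q<q′) ⟩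
  q′ ℤ.* + d               ≤R.≤⟨ ℤ.i≤j+i (q′ ℤ.* + d) (+ ρ′) ⟩
  + ρ′ ℤ.+ q′ ℤ.* + d      ≤R.∎)

÷-unique : ∀ {d ρ} q → ρ < d → (+ ρ ℤ.+ q ℤ.* + d) ÷ (+ d) ≡ q
÷-unique {suc d} {ρ} q ρ<d = ℤ.≤-antisym
  (quotient-≤ q q′ ρ<d eq)
  (quotient-≤ q′ q (ℤ.n%d<d x +[1+ d ]) (sym eq))
  where
  x  = + ρ ℤ.+ q ℤ.* +[1+ d ]
  q′ = x ℤ./ +[1+ d ]

  eq : x ≡ + (x ℤ.% +[1+ d ]) ℤ.+ q′ ℤ.* +[1+ d ]
  eq = ℤ.a≡a%n+[a/n]*n x +[1+ d ]

-- Turns a signed digit of absolute value at most `n` into an ordinary remainder.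
nonneg-shift : ∀ i {n} → ∣ i ∣ ≤ n → ∃[ m ] i ℤ.+ + n ≡ + m
nonneg-shift (+ k)    {n} i≤n = k + n , refl
nonneg-shift -[1+ k ] {n} i≤n = n ∸ suc k , ℤ.⊖-≥ i≤n

-- Sums, norms and determinants

∣sum∣≤ : ∀ {n A} (f : Vector ℤ n) → (∀ i → ∣ f i ∣ ≤ A) → ∣ sum f ∣ ≤ n * A
∣sum∣≤ {zero}  f f≤ = z≤n
∣sum∣≤ {suc n} f f≤ = ≤-trans (ℤ.∣i+j∣≤∣i∣+∣j∣ (f zero) (sum (f ∘ suc)))
  (+-mono-≤ (f≤ zero) (∣sum∣≤ (f ∘ suc) (f≤ ∘ suc)))

kronecker : ∀ {n} → Fin n → Vector ℤ n
kronecker zero    = 1ℤ Vector.∷ λ _ → 0ℤ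
kronecker (suc j) = 0ℤ Vector.∷ kronecker j

sum-kronecker : ∀ {n} (j : Fin n) (f : Vector ℤ n) → sum (λ i → kronecker j i ℤ.* f i) ≡ f j
sum-kronecker {suc n} zero f = trans
  (cong₂ ℤ._+_ (ℤ.*-identityˡ (f zero)) (sum-replicate-zero n))
  (ℤ.+-identityʳ (f zero))
sum-kronecker (suc j) f = trans (ℤ.+-identityˡ _) (sum-kronecker j (f ∘ suc))

m≤m*m : ∀ m → m ≤ m * m
m≤m*m zero      = z≤n
m≤m*m m@(suc _) = m≤m*n m m

norm : ∀ {n} → Vector ℤ n → ℕ
norm {zero}  v = 0
norm {suc n} v = ∣ v zero ∣ * ∣ v zero ∣ + norm (v ∘ suc)

square≡ : ∀ z → z ℤ.* z ≡ + (∣ z ∣ * ∣ z ∣)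
square≡ z = trans (sym (ℤ.0≤i⇒+∣i∣≡i (0≤z*z z))) (cong +_ (ℤ.∣i*j∣≡∣i∣*∣j∣ z z))
  where
  0≤z*z : ∀ z → 0ℤ ℤ.≤ z ℤ.* z
  0≤z*z (+ zero)  = ℤ.+≤+ z≤n
  0≤z*z +[1+ n ]  = ℤ.+≤+ z≤n
  0≤z*z -[1+ n ]  = ℤ.+≤+ z≤n

∥∥²≡norm : ∀ {n} (v : Vector ℤ n) → ∥ v ∥² ≡ + norm v
∥∥²≡norm {zero}  v = refl
∥∥²≡norm {suc n} v = cong₂ ℤ._+_ (square≡ (v zero)) (∥∥²≡norm (v ∘ suc))

∣vᵢ∣²≤norm : ∀ {n} (v : Vector ℤ n) i → ∣ v i ∣ * ∣ v i ∣ ≤ norm v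
∣vᵢ∣²≤norm v zero    = m≤m+n _ _
∣vᵢ∣²≤norm v (suc i) = ≤-trans (∣vᵢ∣²≤norm (v ∘ suc) i) (m≤n+m _ _)

∣vᵢ∣≤norm : ∀ {n} (v : Vector ℤ n) i → ∣ v i ∣ ≤ norm v
∣vᵢ∣≤norm v i = ≤-trans (m≤m*m ∣ v i ∣) (∣vᵢ∣²≤norm v i)

-- The product is at most the larger of the two squares. Bounding both factors by the norm would
-- make the cross term quadratic in the norm.
∣vᵢvⱼ∣≤norm : ∀ {n} (v : Vector ℤ n) i j → ∣ v i ℤ.* v j ∣ ≤ norm v
∣vᵢvⱼ∣≤norm v i j = subst (_≤ norm v) (sym (ℤ.∣i*j∣≡∣i∣*∣j∣ (v i) (v j))) bound
  where
  bound : ∣ v i ∣ * ∣ v j ∣ ≤ norm v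
  bound with ≤-total ∣ v i ∣ ∣ v j ∣
  ... | inj₁ i≤j = ≤-trans (*-monoˡ-≤ ∣ v j ∣ i≤j) (∣vᵢ∣²≤norm v j)
  ... | inj₂ j≤i = ≤-trans (*-monoʳ-≤ ∣ v i ∣ j≤i) (∣vᵢ∣²≤norm v i)

norm≤ : ∀ {n A} (v : Vector ℤ n) → (∀ i → ∣ v i ∣ ≤ A) → norm v ≤ n * (A * A)
norm≤ {zero}  v v≤ = z≤n
norm≤ {suc n} v v≤ = +-mono-≤ (*-mono-≤ (v≤ zero) (v≤ zero)) (norm≤ (v ∘ suc) (v≤ ∘ suc))

sum-scale : ∀ {n} c (f : Vector ℤ n) → sum (λ i → c ℤ.* f i) ≡ c ℤ.* sum f
sum-scale c f = sym (*-distribˡ-sum c f)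

minor : ∀ {n} → Matrix (suc n) → Fin (suc n) → Matrix n
minor A j i k = A (suc i) (punchIn j k)

cofactorTerm : ∀ {n} → Matrix (suc n) → Vector ℤ (suc n)
cofactorTerm A j = -1ℤ ℤ.^ toℕ j ℤ.* A zero j ℤ.* det (minor A j)

det-cong : ∀ {n} {A B : Matrix n} → (∀ i j → A i j ≡ B i j) → det A ≡ det B
det-cong {zero}  A≗B = refl
det-cong {suc n} A≗B = sum-cong-≗ λ j → cong₂ ℤ._*_
  (cong (-1ℤ ℤ.^ toℕ j ℤ.*_) (A≗B zero j))
  (det-cong λ i k → A≗B (suc i) (punchIn j k))

det-scale : ∀ {n} c (A : Matrix n) → det (λ i j → c ℤ.* A i j) ≡ c ℤ.^ n ℤ.* det A
det-scale {zero}  c A = refl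
det-scale {suc n} c A = trans
  (sum-cong-≗ λ j → trans
    (cong (-1ℤ ℤ.^ toℕ j ℤ.* (c ℤ.* A zero j) ℤ.*_) (det-scale c (minor A j)))
    (rearrange (-1ℤ ℤ.^ toℕ j) c (A zero j) (c ℤ.^ n) (det (minor A j))))
  (sum-scale (c ℤ.^ suc n) (cofactorTerm A))
  where
  rearrange : ∀ s c a p d → s ℤ.* (c ℤ.* a) ℤ.* (p ℤ.* d) ≡ c ℤ.* p ℤ.* (s ℤ.* a ℤ.* d)
  rearrange = ℤSolver.solve-∀

∣-1^∣ : ∀ k → ∣ -1ℤ ℤ.^ k ∣ ≡ 1
∣-1^∣ zero    = refl
∣-1^∣ (suc k) = trans (ℤ.∣i*j∣≡∣i∣*∣j∣ -1ℤ (-1ℤ ℤ.^ k)) (trans (*-identityˡ _) (∣-1^∣ k))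

∣±xy∣≤ : ∀ k {x y a b} → ∣ x ∣ ≤ a → ∣ y ∣ ≤ b → ∣ -1ℤ ℤ.^ k ℤ.* x ℤ.* y ∣ ≤ a * b
∣±xy∣≤ k {x} {y} x≤ y≤ = subst (_≤ _) (sym abs) (*-mono-≤ x≤ y≤)
  where
  abs : ∣ -1ℤ ℤ.^ k ℤ.* x ℤ.* y ∣ ≡ ∣ x ∣ * ∣ y ∣
  abs = trans (ℤ.∣i*j∣≡∣i∣*∣j∣ (-1ℤ ℤ.^ k ℤ.* x) y) (cong (_* ∣ y ∣)
    (trans (ℤ.∣i*j∣≡∣i∣*∣j∣ (-1ℤ ℤ.^ k) x)
      (trans (cong (_* ∣ x ∣) (∣-1^∣ k)) (*-identityˡ ∣ x ∣))))

-- Each expansion step contributes the number of terms times the entry bound, and `T` absorbs both.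
-- Fixing `T` beforehand lets it serve all smaller minors.
∣det∣≤ : ∀ {n U T} (A : Matrix n) → (∀ i j → ∣ A i j ∣ ≤ U) → n * U ≤ T → ∣ det A ∣ ≤ T ^ n
∣det∣≤ {zero}  A A≤ nU≤T = ≤-refl
∣det∣≤ {suc n} {U} {T} A A≤ nU≤T = begin
  ∣ det A ∣             ≤⟨ ∣sum∣≤ (cofactorTerm A) (λ j → ∣±xy∣≤ (toℕ j) {A zero j} (A≤ zero j)
                            (∣det∣≤ (minor A j) (λ i k → A≤ (suc i) (punchIn j k))
                              (≤-trans (m≤n+m (n * U) U) nU≤T))) ⟩
  suc n * (U * T ^ n)   ≡⟨ *-assoc (suc n) U (T ^ n) ⟨
  suc n * U * T ^ n     ≤⟨ *-monoˡ-≤ (T ^ n) nU≤T ⟩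
  T * T ^ n             ∎

-- The minors along row 0 avoid that row, so each carries a factor `c ^ n`, and the two summands of
-- row 0 separate by linearity.
det-add-to-first-row : ∀ {n} c (A B : Matrix (suc n)) r →
  (∀ j → B zero j ≡ c ℤ.* A zero j ℤ.+ r j) →
  (∀ i j → B (suc i) j ≡ c ℤ.* A (suc i) j) →
  det B ≡ c ℤ.^ n ℤ.* (c ℤ.* det A ℤ.+ det (r Vector.∷ (A ∘ suc)))
det-add-to-first-row {n} c A B r first others = trans
  (sum-cong-≗ λ j → trans
    (cong₂ (λ x y → -1ℤ ℤ.^ toℕ j ℤ.* x ℤ.* y) (first j)
      (trans (det-cong λ i k → others i (punchIn j k)) (det-scale c (minor A j))))
    (rearrange (-1ℤ ℤ.^ toℕ j) c (A zero j) (r j) (c ℤ.^ n) (det (minor A j))))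
  (trans (sum-scale (c ℤ.^ n) λ j → c ℤ.* s j ℤ.+ t j) (cong (c ℤ.^ n ℤ.*_)
    (trans (∑-distrib-+ (λ j → c ℤ.* s j) t) (cong (ℤ._+ sum t) (sum-scale c s)))))
  where
  s = cofactorTerm A
  t = cofactorTerm (r Vector.∷ (A ∘ suc))

  rearrange : ∀ s c a r p d → s ℤ.* (c ℤ.* a ℤ.+ r) ℤ.* (p ℤ.* d) ≡
              p ℤ.* (c ℤ.* (s ℤ.* a ℤ.* d) ℤ.+ s ℤ.* r ℤ.* d)
  rearrange = ℤSolver.solve-∀

-- Otherwise the expansion along row 0 vanishes. This provides a nonzero column, whose length bounds
-- λ₁.
nonsingular-first-row : ∀ {n} (A : Matrix (suc n)) → Nonsingular A → ∃[ j ] A zero j ≢ 0ℤ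
nonsingular-first-row {n} A det≢0 with Fin.any? (λ j → ¬? (A zero j ℤ.≟ 0ℤ))
... | yes found = found
... | no none = contradiction (trans
  (sum-cong-≗ λ j → trans
    (cong (λ x → -1ℤ ℤ.^ toℕ j ℤ.* x ℤ.* det (minor A j))
      (decidable-stable (A zero j ℤ.≟ 0ℤ) λ A≢0 → none (j , A≢0)))
    (cong (ℤ._* det (minor A j)) (ℤ.*-zeroʳ (-1ℤ ℤ.^ toℕ j))))
  (sum-replicate-zero (suc n))) det≢0

column∈L : ∀ {n} (B : Matrix n) j → (λ i → B i j) ∈L B
column∈L B j = kronecker j , λ i → sym (sum-kronecker j (B i))

-- Base `D` expansions

module _ (D : ℕ) where

  -- The form ℓ, nested so that coordinate 0 is the lowest digit and comes off by one division by
  -- `D`.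
  horner : ∀ {n} → Vector ℤ n → ℤ
  horner {zero}  v = 0ℤ
  horner {suc n} v = v zero ℤ.+ + D ℤ.* horner (v ∘ suc)

  -- The value `1 + D + … + D ^ (n - 1)` of the digits 1, ..., 1: the factor by which ℓ enlarges a
  -- bound on the coordinates.
  repunit : ℕ → ℕ
  repunit zero    = 0
  repunit (suc n) = 1 + D * repunit n

  repunit<D^ : 2 ≤ D → ∀ n → repunit n < D ^ n
  repunit<D^ 2≤D zero    = s≤s z≤n
  repunit<D^ 2≤D (suc n) = begin
    2 + D * repunit n    ≤⟨ +-monoˡ-≤ (D * repunit n) 2≤D ⟩
    D + D * repunit n    ≡⟨ *-suc D (repunit n) ⟨
    D * suc (repunit n)  ≤⟨ *-monoʳ-≤ D (repunit<D^ 2≤D n) ⟩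
    D * D ^ n            ∎

  horner-cong : ∀ {n} {u v : Vector ℤ n} → (∀ i → u i ≡ v i) → horner u ≡ horner v
  horner-cong {zero}  u≗v = refl
  horner-cong {suc n} u≗v =
    cong₂ (λ x y → x ℤ.+ + D ℤ.* y) (u≗v zero) (horner-cong (u≗v ∘ suc))

  horner-scale : ∀ {n} c (v : Vector ℤ n) → horner (λ i → c ℤ.* v i) ≡ c ℤ.* horner v
  horner-scale {zero}  c v = sym (ℤ.*-zeroʳ c)
  horner-scale {suc n} c v = trans
    (cong (λ y → c ℤ.* v zero ℤ.+ + D ℤ.* y) (horner-scale c (v ∘ suc)))
    (rearrange c (v zero) (+ D) (horner (v ∘ suc)))
    where
    rearrange : ∀ c x d h → c ℤ.* x ℤ.+ d ℤ.* (c ℤ.* h) ≡ c ℤ.* (x ℤ.+ d ℤ.* h)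
    rearrange = ℤSolver.solve-∀

  -- Linearity of ℓ: changing row 0 of the basis by ℓ of its columns changes coordinate 0 of every
  -- lattice vector by ℓ of the vector itself.
  horner-combination : ∀ {m n} (x : Vector ℤ m) (A : Fin n → Fin m → ℤ) →
    horner (λ i → sum λ j → x j ℤ.* A i j) ≡ sum λ j → x j ℤ.* horner λ i → A i j
  horner-combination {m} {zero} x A = sym (trans
    (sum-cong-≗ λ j → ℤ.*-zeroʳ (x j)) (sum-replicate-zero m))
  horner-combination {m} {suc n} x A = trans
    (cong (λ y → first ℤ.+ + D ℤ.* y) (horner-combination x (A ∘ suc)))
    (trans (cong (λ y → first ℤ.+ y) (*-distribˡ-sum (+ D) rest))
      (trans (sym (∑-distrib-+ (λ j → x j ℤ.* A zero j) (λ j → + D ℤ.* rest j)))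
        (sum-cong-≗ λ j → rearrange (x j) (A zero j) (+ D) (horner λ i → A (suc i) j))))
    where
    first = sum λ j → x j ℤ.* A zero j
    rest : Vector ℤ m
    rest j = x j ℤ.* horner λ i → A (suc i) j

    rearrange : ∀ x a d h → x ℤ.* a ℤ.+ d ℤ.* (x ℤ.* h) ≡ x ℤ.* (a ℤ.+ d ℤ.* h)
    rearrange = ℤSolver.solve-∀

  ∣horner∣≤ : ∀ {n A} (v : Vector ℤ n) → (∀ i → ∣ v i ∣ ≤ A) → ∣ horner v ∣ ≤ A * repunit n
  ∣horner∣≤ {zero} v v≤ = z≤n
  ∣horner∣≤ {suc n} {A} v v≤ = begin
    ∣ v zero ℤ.+ + D ℤ.* h ∣     ≤⟨ ℤ.∣i+j∣≤∣i∣+∣j∣ (v zero) (+ D ℤ.* h) ⟩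
    ∣ v zero ∣ + ∣ + D ℤ.* h ∣   ≡⟨ cong (λ y → ∣ v zero ∣ + y) (ℤ.∣i*j∣≡∣i∣*∣j∣ (+ D) h) ⟩
    ∣ v zero ∣ + D * ∣ h ∣       ≤⟨ +-mono-≤ (v≤ zero) (*-monoʳ-≤ D (∣horner∣≤ (v ∘ suc) (v≤ ∘ suc))) ⟩
    A + D * (A * repunit n)      ≡⟨ rearrange A D (repunit n) ⟩
    A * (1 + D * repunit n)      ∎
    where
    h = horner (v ∘ suc)
    rearrange : ∀ a d r → a + d * (a * r) ≡ a * (1 + d * r)
    rearrange = ℕSolver.solve-∀

-- Estimates for the perturbation

-- Row 0 has its own bound because it will hold values of ℓ, of size about `U * Q`. A common bound
-- would put `Q` to the power of the dimension, while `K` contains only its square.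
∣det∣≤′ : ∀ {n R U T} (A : Matrix (suc n)) → (∀ j → ∣ A zero j ∣ ≤ R) →
          (∀ i j → ∣ A (suc i) j ∣ ≤ U) → n * U ≤ T → ∣ det A ∣ ≤ suc n * (R * T ^ n)
∣det∣≤′ A first≤ others≤ nU≤T = ∣sum∣≤ (cofactorTerm A) λ j →
  ∣±xy∣≤ (toℕ j) {A zero j} (first≤ j) (∣det∣≤ (minor A j) (λ i k → others≤ i (punchIn j k)) nU≤T)

-- A zero sum would give `∣ δ ∣ = k * ∣ d ∣ ≥ k`.
multiple+small≢0 : ∀ {k d δ} → d ≢ 0ℤ → ∣ δ ∣ < k → + k ℤ.* d ℤ.+ δ ≢ 0ℤ
multiple+small≢0 {k} {d} {δ} d≢0 ∣δ∣<k sum≡0 = <⇒≱ ∣δ∣<k (begin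
  k                               ≡⟨ *-identityʳ k ⟨
  k * 1                           ≤⟨ *-monoʳ-≤ k (n≢0⇒n>0 λ ∣d∣≡0 → d≢0 (ℤ.∣i∣≡0⇒i≡0 ∣d∣≡0)) ⟩
  k * ∣ d ∣                       ≡⟨ ℤ.∣i*j∣≡∣i∣*∣j∣ (+ k) d ⟨
  ∣ + k ℤ.* d ∣                   ≡⟨ cong ∣_∣ (cancel (+ k ℤ.* d) δ) ⟩
  ∣ + k ℤ.* d ℤ.+ δ ℤ.- δ ∣       ≡⟨ cong (λ y → ∣ y ℤ.- δ ∣) sum≡0 ⟩
  ∣ 0ℤ ℤ.- δ ∣                    ≡⟨ cong ∣_∣ (ℤ.+-identityˡ (ℤ.- δ)) ⟩
  ∣ ℤ.- δ ∣                       ≡⟨ ℤ.∣-i∣≡∣i∣ δ ⟩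
  ∣ δ ∣                           ∎)
  where
  cancel : ∀ x y → x ≡ x ℤ.+ y ℤ.- y
  cancel = ℤSolver.solve-∀

∣i∣≤n⇒i≤n : ∀ {i n} → ∣ i ∣ ≤ n → i ℤ.≤ + n
∣i∣≤n⇒i≤n {+ _}      i≤n = ℤ.+≤+ i≤n
∣i∣≤n⇒i≤n { -[1+ _ ]} i≤n = ℤ.-≤+

-- Carries the expansion of `∥ w ∥²` over to ℕ. The cross term moves to the other side in the lower
-- bound, where the square of `h` is dropped as nonnegative.
quadratic-bounds : ∀ {k n q t a h} →
  + t ≡ + k ℤ.* + k ℤ.* + n ℤ.+ (+ k ℤ.* a ℤ.+ + k ℤ.* a) ℤ.+ h ℤ.* h → ∣ a ∣ ≤ q →
  k * k * n ≤ t + (k * q + k * q) × t ≤ k * k * n + (k * q + k * q) + ∣ h ∣ * ∣ h ∣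
quadratic-bounds {k} {n} {q} {t} {a} {h} t≡ ∣a∣≤q = lower , upper
  where
  kkn≡ : + k ℤ.* + k ℤ.* + n ≡ + (k * k * n)
  kkn≡ = trans (cong (ℤ._* + n) (sym (ℤ.pos-* k k))) (sym (ℤ.pos-* (k * k) n))

  ka≤ : ∀ {b} → ∣ b ∣ ≤ q → + k ℤ.* b ℤ.≤ + (k * q)
  ka≤ ∣b∣≤q = ℤ.≤-trans (ℤ.*-monoˡ-≤-nonNeg (+ k) (∣i∣≤n⇒i≤n ∣b∣≤q)) (ℤ.≤-reflexive (sym (ℤ.pos-* k q)))

  k[-a]≤ : + k ℤ.* (ℤ.- a) ℤ.≤ + (k * q)
  k[-a]≤ = ka≤ (subst (_≤ q) (sym (ℤ.∣-i∣≡∣i∣ a)) ∣a∣≤q)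

  upper : t ≤ k * k * n + (k * q + k * q) + ∣ h ∣ * ∣ h ∣
  upper = ℤ.drop‿+≤+ (ℤ.≤-trans (ℤ.≤-reflexive t≡)
    (ℤ.+-mono-≤ (ℤ.+-mono-≤ (ℤ.≤-reflexive kkn≡) (ℤ.+-mono-≤ (ka≤ ∣a∣≤q) (ka≤ ∣a∣≤q)))
      (ℤ.≤-reflexive (square≡ h))))

  move : ∀ x y h → x ≡ x ℤ.+ (y ℤ.+ y) ℤ.+ h ℤ.+ (ℤ.- y ℤ.+ ℤ.- y) ℤ.- h
  move = ℤSolver.solve-∀

  -h²≤0 : ℤ.- (h ℤ.* h) ℤ.≤ 0ℤ
  -h²≤0 = subst (λ y → ℤ.- y ℤ.≤ 0ℤ) (sym (square≡ h)) (ℤ.neg-mono-≤ (ℤ.+≤+ z≤n))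

  -ka≤ : ℤ.- (+ k ℤ.* a) ℤ.≤ + (k * q)
  -ka≤ = subst (ℤ._≤ + (k * q)) (sym (ℤ.neg-distribʳ-* (+ k) a)) k[-a]≤

  lower : k * k * n ≤ t + (k * q + k * q)
  lower = ℤ.drop‿+≤+ (ℤ.≤-trans
    (ℤ.≤-reflexive (trans (sym kkn≡) (move (+ k ℤ.* + k ℤ.* + n) (+ k ℤ.* a) (h ℤ.* h))))
    (ℤ.≤-trans (ℤ.+-mono-≤ (ℤ.+-mono-≤ (ℤ.≤-reflexive (sym t≡)) (ℤ.+-mono-≤ -ka≤ -ka≤)) -h²≤0)
      (ℤ.≤-reflexive (ℤ.+-identityʳ _))))

norm≡0 : ∀ {n} (v : Vector ℤ n) → norm v ≡ 0 → ∀ i → v i ≡ 0ℤ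
norm≡0 v eq i = ℤ.∣i∣≡0⇒i≡0 (n≤0⇒n≡0 (subst (∣ v i ∣ ≤_) eq (∣vᵢ∣≤norm v i)))

combination : ∀ {n} → Matrix n → Vector ℤ n → Vector ℤ n
combination B x i = sum λ j → x j ℤ.* B i j

combination-scale : ∀ {n} c (B : Matrix n) x i →
                    combination B (λ j → c ℤ.* x j) i ≡ c ℤ.* combination B x i
combination-scale c B x i =
  trans (sum-cong-≗ λ j → ℤ.*-assoc c (x j) (B i j)) (sum-scale c λ j → x j ℤ.* B i j)

norm-zero : ∀ {n} {v : Vector ℤ n} → (∀ i → v i ≡ 0ℤ) → norm v ≡ 0
norm-zero {zero}  v≡0 = refl
norm-zero {suc n} v≡0 =
  cong₂ (λ y z → ∣ y ∣ * ∣ y ∣ + z) (v≡0 zero) (norm-zero (v≡0 ∘ suc))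

-- Suppose `N = N₀ + 1 + d`. The left side then exceeds `K² N₀` by `K² (d + 1)`. The rest of the
-- right side is `4 K Q N₀ + c₀ + 2 K Q (d + 1)`, at most `7 K E (d + 1)` and hence smaller. In the
-- main use `c₀` is the square of ℓ at a shortest vector.
perturbation-negligible : ∀ {K E Q G c₀} N N₀ → 1 ≤ G → Q * G ≤ E → 7 * E < K →
  N₀ ≤ G → c₀ ≤ E * E →
  K * K * N ≤ K * K * N₀ + (K * (Q * N₀) + K * (Q * N₀)) + c₀ + (K * (Q * N) + K * (Q * N)) →
  N ≤ N₀
perturbation-negligible {K} {E} {Q} {G} {c₀} N N₀ 1≤G QG≤E 7E<K N₀≤G c₀≤E² hyp = ≮⇒≥ absurd
  where
  Q≤E : Q ≤ E
  Q≤E = ≤-trans (subst (_≤ Q * G) (*-identityʳ Q) (*-monoʳ-≤ Q 1≤G)) QG≤E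

  E≤K : E ≤ K
  E≤K = ≤-trans (m≤m+n E (6 * E)) (<⇒≤ 7E<K)

  QN₀≤E : Q * N₀ ≤ E
  QN₀≤E = ≤-trans (*-monoʳ-≤ Q N₀≤G) QG≤E

  spread : ∀ k e q n d c → k * k * n + (k * (q * n) + k * (q * n)) + c + (k * (q * (suc n + d)) + k * (q * (suc n + d)))
           ≡ k * k * n + (4 * (k * (q * n)) + c + 2 * (k * (q * suc d)))
  spread = ℕSolver.solve-∀

  gather : ∀ k e d → 4 * (k * e) + e * k + 2 * (k * (e * suc d)) + 5 * (k * (e * d)) ≡ k * (7 * e) * suc d
  gather = ℕSolver.solve-∀

  split : ∀ k n d → k * k * n + k * k * suc d ≡ k * k * (suc n + d)
  split = ℕSolver.solve-∀

  1≤K : 1 ≤ K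
  1≤K = ≤-trans (s≤s z≤n) 7E<K

  absurd : ¬ N₀ < N
  absurd N₀<N with d , refl ← m≤n⇒∃[o]m+o≡n N₀<N = <⇒≱ (begin-strict
    K * K * N₀ + (K * (Q * N₀) + K * (Q * N₀)) + c₀ + (K * (Q * N) + K * (Q * N))
      ≡⟨ spread K E Q N₀ d c₀ ⟩
    K * K * N₀ + (4 * (K * (Q * N₀)) + c₀ + 2 * (K * (Q * suc d)))
      ≤⟨ +-monoʳ-≤ (K * K * N₀) (+-mono-≤
           (+-mono-≤ (*-monoʳ-≤ 4 (*-monoʳ-≤ K QN₀≤E)) (≤-trans c₀≤E² (*-monoʳ-≤ E E≤K)))
           (*-monoʳ-≤ 2 (*-monoʳ-≤ K (*-monoˡ-≤ (suc d) Q≤E)))) ⟩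
    K * K * N₀ + (4 * (K * E) + E * K + 2 * (K * (E * suc d)))
      -- Adding `5 K E d` raises the constant part `4 + 1` to a multiple of `suc d`.
      ≤⟨ +-monoʳ-≤ (K * K * N₀) (m≤m+n _ (5 * (K * (E * d)))) ⟩
    K * K * N₀ + (4 * (K * E) + E * K + 2 * (K * (E * suc d)) + 5 * (K * (E * d)))
      ≡⟨ cong (λ y → K * K * N₀ + y) (gather K E d) ⟩
    K * K * N₀ + K * (7 * E) * suc d
      <⟨ +-monoʳ-< (K * K * N₀) (*-monoˡ-< (suc d) (*-monoʳ-< K {{>-nonZero 1≤K}} 7E<K)) ⟩
    K * K * N₀ + K * K * suc d
      ≡⟨ split K N₀ d ⟩
    K * K * N ∎) hyp

-- The perturbed basis

-- Propositional equations, because definitions would be unfolded to towers of products.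
record Scales (U n : ℕ) : Set where
  field
    {G D Q K} : ℕ
    G≡        : G ≡ U * U * U
    D≡        : D ≡ G + G + 1
    Q≡        : Q ≡ D ^ n
    K≡        : K ≡ 8 * (Q * G * (Q * G))

module ScaleBounds {U n} (s : Scales U n) (1≤U : 1 ≤ U) where
  open Scales s

  -- Bounds ∣ℓ(v)∣ for every v of squared length at most `G`.
  E : ℕ
  E = Q * G

  1≤G : 1 ≤ G
  1≤G = subst (1 ≤_) (sym G≡) (*-mono-≤ (*-mono-≤ 1≤U 1≤U) 1≤U)

  G≤D : G ≤ D
  G≤D = subst (G ≤_) (sym D≡) (≤-trans (m≤m+n G G) (m≤m+n (G + G) 1))

  U≤U² : U ≤ U * U
  U≤U² = subst (_≤ U * U) (*-identityʳ U) (*-monoʳ-≤ U 1≤U)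

  U²≤G : U * U ≤ G
  U²≤G = subst₂ _≤_ (*-identityʳ (U * U)) (sym G≡) (*-monoʳ-≤ (U * U) 1≤U)

  2≤D : 2 ≤ D
  2≤D = subst (2 ≤_) (sym D≡) (≤-trans (+-mono-≤ 1≤G 1≤G) (m≤m+n (G + G) 1))

  repunit≤Q : repunit D n ≤ Q
  repunit≤Q = subst (repunit D n ≤_) (sym Q≡) (<⇒≤ (repunit<D^ D 2≤D n))

  1≤Q : 1 ≤ Q
  1≤Q = subst (1 ≤_) (sym Q≡) (≤-trans (s≤s z≤n) (repunit<D^ D 2≤D n))

  1≤E : 1 ≤ E
  1≤E = *-mono-≤ 1≤Q 1≤G

  Q≤E : Q ≤ E
  Q≤E = subst (_≤ E) (*-identityʳ Q) (*-monoʳ-≤ Q 1≤G)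

  G≤E : G ≤ E
  G≤E = subst (_≤ E) (*-identityˡ G) (*-monoˡ-≤ G 1≤Q)

  E≤E² : E ≤ E * E
  E≤E² = subst (_≤ E * E) (*-identityʳ E) (*-monoʳ-≤ E 1≤E)

  -- Makes ℓ(v)², for a shortest v, its own remainder modulo `K`.
  E²<K : E * E < K
  E²<K = subst (E * E <_) (sym K≡) (m<m+n (E * E) (≤-trans (*-mono-≤ 1≤E 1≤E) (m≤m+n (E * E) _)))

  7E<K : 7 * E < K
  7E<K = begin-strict
    7 * E          <⟨ m<n+m (7 * E) 1≤E ⟩
    8 * E          ≤⟨ *-monoʳ-≤ 8 E≤E² ⟩
    8 * (E * E)    ≡⟨ K≡ ⟨
    K              ∎

  E≤K : E ≤ K
  E≤K = ≤-trans E≤E² (<⇒≤ E²<K)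

  1≤K : 1 ≤ K
  1≤K = ≤-trans 1≤E E≤K

module Perturbation {m} (B : Matrix (suc m)) (det≢0 : Nonsingular B)
  {U} (n≤U : suc m ≤ U) (B≤U : ∀ i j → ∣ B i j ∣ ≤ U) (s : Scales U (suc m)) where

  open Scales s
  open ScaleBounds s (≤-trans (s≤s z≤n) n≤U)

  n : ℕ
  n = suc m

  row : Vector ℤ n
  row j = horner D λ i → B i j

  ∣row∣≤ : ∀ j → ∣ row j ∣ ≤ U * Q
  ∣row∣≤ j = ≤-trans (∣horner∣≤ D (λ i → B i j) (λ i → B≤U i j))
    (*-monoʳ-≤ U repunit≤Q)

  -- The lower rows and the factor `n` contribute powers of `U` that disappear in `D ^ n = Q`,
  -- because `U² ≤ D`; row 0 contributes another `Q`.
  ∣det-row∣<K : ∣ det (row Vector.∷ (B ∘ suc)) ∣ < K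
  ∣det-row∣<K = begin-strict
    ∣ det (row Vector.∷ (B ∘ suc)) ∣
      ≤⟨ ∣det∣≤′ (row Vector.∷ (B ∘ suc)) ∣row∣≤ (λ i → B≤U (suc i))
           (*-monoˡ-≤ U (≤-trans (n≤1+n m) n≤U)) ⟩
    n * (U * Q * (U * U) ^ m)        ≤⟨ *-monoˡ-≤ (U * Q * (U * U) ^ m) n≤U ⟩
    U * (U * Q * (U * U) ^ m)        ≡⟨ rearrange U Q ((U * U) ^ m) ⟩
    Q * (U * U) ^ n                  ≤⟨ *-monoʳ-≤ Q (^-monoˡ-≤ n (≤-trans U²≤G G≤D)) ⟩
    Q * D ^ n                        ≡⟨ cong (λ y → Q * y) Q≡ ⟨
    Q * Q                            ≤⟨ *-mono-≤ Q≤E Q≤E ⟩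
    E * E                            <⟨ E²<K ⟩
    K                                ∎
    where
    rearrange : ∀ u q p → u * (u * q * p) ≡ q * (u * u * p)
    rearrange = ℕSolver.solve-∀

  -- Witnessed by a nonzero column of `B`.
  λ₁²≤G : ∀ {k} → Isλ₁² B k → k ℤ.≤ + G
  λ₁²≤G (_ , shortest) with j , Bj≢0 ← nonsingular-first-row B det≢0 =
    ℤ.≤-trans (shortest column (column∈L B j) λ column≡0 → Bj≢0 (column≡0 zero))
      (subst (ℤ._≤ + G) (sym (∥∥²≡norm column)) (ℤ.+≤+ (begin
        norm column     ≤⟨ norm≤ column (λ i → B≤U i j) ⟩
        n * (U * U)     ≤⟨ *-monoˡ-≤ (U * U) n≤U ⟩
        U * (U * U)     ≡⟨ trans (sym (*-assoc U U U)) (sym G≡) ⟩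
        G               ∎)))
    where
    column : Vector ℤ n
    column i = B i j

  module _ {B′ : Matrix n}
    (first : ∀ j → B′ zero j ≡ + K ℤ.* B zero j ℤ.+ row j)
    (others : ∀ i j → B′ (suc i) j ≡ + K ℤ.* B (suc i) j) where

    perturbed-nonsingular : Nonsingular B′
    perturbed-nonsingular det′≡0 = [ K^m≢0 , multiple+small≢0 det≢0 ∣det-row∣<K ]′
      (ℤ.i*j≡0⇒i≡0∨j≡0 ((+ K) ℤ.^ m)
        (trans (sym (det-add-to-first-row (+ K) B B′ row first others)) det′≡0))
      where
      K^m≢0 : (+ K) ℤ.^ m ≢ 0ℤ
      K^m≢0 K^m≡0 = <⇒≢ 1≤K (sym (ℤ.+-injective (ℤ.i^n≡0⇒i≡0 (+ K) m K^m≡0)))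

    module _ (x : Vector ℤ n) where
      v w : Vector ℤ n
      v = combination B x
      w = combination B′ x

      h : ℤ
      h = horner D v

      w-first : w zero ≡ + K ℤ.* v zero ℤ.+ h
      w-first = trans (sum-cong-≗ λ j → trans (cong (x j ℤ.*_) (first j)) (expand (x j) (+ K) (B zero j) (row j)))
        (trans (∑-distrib-+ (λ j → + K ℤ.* (x j ℤ.* B zero j)) (λ j → x j ℤ.* row j))
          (cong₂ ℤ._+_ (sum-scale (+ K) (λ j → x j ℤ.* B zero j)) (sym (horner-combination D x B))))
        where
        expand : ∀ x k b r → x ℤ.* (k ℤ.* b ℤ.+ r) ≡ k ℤ.* (x ℤ.* b) ℤ.+ x ℤ.* r
        expand = ℤSolver.solve-∀

      w-others : ∀ i → w (suc i) ≡ + K ℤ.* v (suc i)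
      w-others i = trans (sum-cong-≗ λ j → trans (cong (x j ℤ.*_) (others i j)) (swap (x j) (+ K) (B (suc i) j)))
        (sum-scale (+ K) λ j → x j ℤ.* B (suc i) j)
        where
        swap : ∀ x k b → x ℤ.* (k ℤ.* b) ≡ k ℤ.* (x ℤ.* b)
        swap = ℤSolver.solve-∀

      N : ℕ
      N = norm v

      a : ℤ
      a = v zero ℤ.* h

      ∥w∥²≡ : ∥ w ∥² ≡ + K ℤ.* + K ℤ.* + N ℤ.+ (+ K ℤ.* a ℤ.+ + K ℤ.* a) ℤ.+ h ℤ.* h
      ∥w∥²≡ = trans
        (cong₂ ℤ._+_ (cong₂ ℤ._*_ w-first w-first)
          (trans (sum-cong-≗ λ i → trans (cong₂ ℤ._*_ (w-others i) (w-others i)) (square (+ K) (v (suc i))))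
            (sum-scale (+ K ℤ.* + K) λ i → v (suc i) ℤ.* v (suc i))))
        (trans (expand (+ K) (v zero) h (sum λ i → v (suc i) ℤ.* v (suc i)))
          (cong (λ y → + K ℤ.* + K ℤ.* y ℤ.+ (+ K ℤ.* a ℤ.+ + K ℤ.* a) ℤ.+ h ℤ.* h) (∥∥²≡norm v)))
        where
        square : ∀ k y → (k ℤ.* y) ℤ.* (k ℤ.* y) ≡ k ℤ.* k ℤ.* (y ℤ.* y)
        square = ℤSolver.solve-∀
        expand : ∀ k y h s → (k ℤ.* y ℤ.+ h) ℤ.* (k ℤ.* y ℤ.+ h) ℤ.+ k ℤ.* k ℤ.* s ≡
          k ℤ.* k ℤ.* (y ℤ.* y ℤ.+ s) ℤ.+ (k ℤ.* (y ℤ.* h) ℤ.+ k ℤ.* (y ℤ.* h)) ℤ.+ h ℤ.* h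
        expand = ℤSolver.solve-∀

      -- The factor `v zero` is moved inside ℓ, where products of two coordinates are bounded by the
      -- norm.
      ∣a∣≤ : ∣ a ∣ ≤ Q * N
      ∣a∣≤ = begin
        ∣ v zero ℤ.* h ∣                         ≡⟨ cong ∣_∣ (horner-scale D (v zero) v) ⟨
        ∣ horner D (λ i → v zero ℤ.* v i) ∣      ≤⟨ ∣horner∣≤ D (λ i → v zero ℤ.* v i) (∣vᵢvⱼ∣≤norm v zero) ⟩
        N * repunit D n                          ≤⟨ *-monoʳ-≤ N repunit≤Q ⟩
        N * Q                                    ≡⟨ *-comm N Q ⟩
        Q * N                                    ∎

      ∣h∣≤ : ∣ h ∣ ≤ Q * N
      ∣h∣≤ = ≤-trans (∣horner∣≤ D v (∣vᵢ∣≤norm v))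
        (≤-trans (*-monoʳ-≤ N repunit≤Q) (≤-reflexive (*-comm N Q)))

      w-lower : K * K * N ≤ norm w + (K * (Q * N) + K * (Q * N))
      w-lower = proj₁ (quadratic-bounds {K} {N} {a = a} {h} (trans (sym (∥∥²≡norm w)) ∥w∥²≡) ∣a∣≤)

      w-upper : norm w ≤ K * K * N + (K * (Q * N) + K * (Q * N)) + ∣ h ∣ * ∣ h ∣
      w-upper = proj₂ (quadratic-bounds {K} {N} {a = a} {h} (trans (sym (∥∥²≡norm w)) ∥w∥²≡) ∣a∣≤)

    record Decoding (k : ℤ) : Set where
      field
        {vector}   : Vector ℤ n
        {root}     : ℕ
        {quotient} : ℤ
        ∈lattice   : vector ∈L B
        shortest   : Isλ₁² B ∥ vector ∥²
        ∣vector∣≤  : ∀ i → ∣ vector i ∣ ≤ G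
        horner≡    : horner D vector ≡ + root
        k≡         : k ≡ + (root * root) ℤ.+ quotient ℤ.* + K
        root≤E     : root ≤ E
        ∣k∣≤       : ∣ k ∣ ≤ 3 * (K * K * G)

    nonzero-v⇐w : ∀ x → Nonzero (w x) → Nonzero (v x)
    nonzero-v⇐w x w≢0 v≡0 = w≢0 w≡0
      where
      K*≡0 : ∀ {z} → z ≡ 0ℤ → + K ℤ.* z ≡ 0ℤ
      K*≡0 refl = ℤ.*-zeroʳ (+ K)

      h≡0 : h x ≡ 0ℤ
      h≡0 = ℤ.∣i∣≡0⇒i≡0 (n≤0⇒n≡0 (subst (∣ h x ∣ ≤_)
        (trans (cong (λ y → Q * y) (norm-zero v≡0)) (*-zeroʳ Q)) (∣h∣≤ x)))

      w≡0 : ∀ i → w x i ≡ 0ℤ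
      w≡0 zero    = trans (w-first x) (cong₂ ℤ._+_ (K*≡0 (v≡0 zero)) h≡0)
      w≡0 (suc i) = trans (w-others x i) (K*≡0 (v≡0 (suc i)))

    nonzero-w⇐v : ∀ x → Nonzero (v x) → Nonzero (w x)
    -- If `w` vanished, its lower bound would read `K² N ≤ 2 K Q N`; the comparison with `N₀ = 0`
    -- then gives `N = 0`.
    nonzero-w⇐v x v≢0 w≡0 = v≢0 (norm≡0 (v x) (n≤0⇒n≡0 (perturbation-negligible
      {E = E} {Q} {G} {0} (N x) 0 1≤G ≤-refl 7E<K z≤n z≤n
      (≤-trans (w-lower x) (≤-trans (≤-reflexive (cong (_+ (K * (Q * N x) + K * (Q * N x))) (norm-zero w≡0)))
        (m≤n+m (K * (Q * N x) + K * (Q * N x)) (K * K * 0 + (K * (Q * 0) + K * (Q * 0)) + 0)))))))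

    -- The remainder shows ℓ(v) only up to sign. Passing from `x` to `-x` keeps the length, so the
    -- sign is chosen to fit the nonnegative root that the program finds.
    oriented : ∀ {k} → Σ[ u ∈ Vector ℤ n ] u ∈L B′ × Nonzero u × ∥ u ∥² ≡ k →
               ∃[ x ] ∃[ r ] (h x ≡ + r × Nonzero (v x) × ∥ w x ∥² ≡ k)
    oriented {k} (u , (x , u≡) , u≢0 , ∥u∥²≡k) with ℤ.+∣i∣≡i⊎+∣i∣≡-i (h x)
    ... | inj₁ ∣h∣≡h = x , ∣ h x ∣ , sym ∣h∣≡h , v≢0 , ∥w∥²≡k
      where
      v≢0 : Nonzero (v x)
      v≢0 = nonzero-v⇐w x λ w≡0 → u≢0 λ i → trans (u≡ i) (w≡0 i)

      ∥w∥²≡k : ∥ w x ∥² ≡ k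
      ∥w∥²≡k = trans (sum-cong-≗ λ i → cong₂ ℤ._*_ (sym (u≡ i)) (sym (u≡ i))) ∥u∥²≡k
    ... | inj₂ ∣h∣≡-h = -x , ∣ h x ∣ , h-x≡ , v≢0 , ∥w∥²≡k
      where
      -x : Vector ℤ n
      -x j = -1ℤ ℤ.* x j

      neg-neg : ∀ {z} → -1ℤ ℤ.* z ≡ 0ℤ → z ≡ 0ℤ
      neg-neg {z} -z≡0 = ℤ.neg-injective (trans (sym (ℤ.-1*i≡-i z)) -z≡0)

      v≢0 : Nonzero (v -x)
      v≢0 = nonzero-v⇐w -x λ w≡0 → u≢0 λ i →
        trans (u≡ i) (neg-neg (trans (sym (combination-scale -1ℤ B′ x i)) (w≡0 i)))

      h-x≡ : h -x ≡ + ∣ h x ∣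
      h-x≡ = trans (horner-cong D (combination-scale -1ℤ B x))
        (trans (horner-scale D -1ℤ (v x)) (trans (ℤ.-1*i≡-i (h x)) (sym ∣h∣≡-h)))

      ∥w∥²≡k : ∥ w -x ∥² ≡ k
      ∥w∥²≡k = trans (sum-cong-≗ λ i → trans
        (cong₂ ℤ._*_ (combination-scale -1ℤ B′ x i) (combination-scale -1ℤ B′ x i))
        (trans (square-neg (w x i)) (cong₂ ℤ._*_ (sym (u≡ i)) (sym (u≡ i))))) ∥u∥²≡k
        where
        square-neg : ∀ y → -1ℤ ℤ.* y ℤ.* (-1ℤ ℤ.* y) ≡ y ℤ.* y
        square-neg = ℤSolver.solve-∀

    -- `x` attains the answer in `L(B′)`, and `x₀` gives a shortest vector of `L(B)`. Minimality in
    -- `L(B)` yields `N₀ ≤ N`, minimality in `L(B′)` yields `N ≤ N₀`, so `B x` is shortest as well.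
    decode : ∀ {k k₀} → Isλ₁² B k₀ → Isλ₁² B′ k → Decoding k
    decode {k} {k₀} isλ₁²@((u₀ , (x₀ , u₀≡) , u₀≢0 , ∥u₀∥²≡k₀) , shortest) (attained , shortest′)
      with x , r , h≡r , v≢0 , ∥w∥²≡k ← oriented attained = record
      { vector    = v x
      ; quotient  = + K ℤ.* + N x ℤ.+ (a x ℤ.+ a x)
      ; ∈lattice  = x , λ _ → refl
      ; shortest  = (v x , (x , λ _ → refl) , v≢0 , refl) ,
                    λ z z∈ z≢0 → subst (ℤ._≤ ∥ z ∥²) k₀≡∥v∥² (shortest z z∈ z≢0)
      ; ∣vector∣≤ = λ i → ≤-trans (∣vᵢ∣≤norm (v x) i) N≤G
      ; horner≡   = h≡r
      ; k≡        = k≡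
      ; root≤E    = ≤-trans (≤-reflexive (cong ∣_∣ (sym h≡r))) ∣h∣≤E
      ; ∣k∣≤      = ∣k∣≤
      }
      where
      N₀ = N x₀

      v₀≢0 : Nonzero (v x₀)
      v₀≢0 v≡0 = u₀≢0 λ i → trans (u₀≡ i) (v≡0 i)

      k₀≡N₀ : k₀ ≡ + N₀
      k₀≡N₀ = trans (sym ∥u₀∥²≡k₀)
        (trans (sum-cong-≗ λ i → cong₂ ℤ._*_ (u₀≡ i) (u₀≡ i)) (∥∥²≡norm (v x₀)))

      N₀≤G : N₀ ≤ G
      N₀≤G = ℤ.drop‿+≤+ (subst (ℤ._≤ + G) k₀≡N₀ (λ₁²≤G isλ₁²))

      N₀≤N : N₀ ≤ N x
      N₀≤N = ℤ.drop‿+≤+ (subst₂ ℤ._≤_ k₀≡N₀ (∥∥²≡norm (v x)) (shortest (v x) (x , λ _ → refl) v≢0))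

      norm-w≤ : norm (w x) ≤ norm (w x₀)
      norm-w≤ = ℤ.drop‿+≤+ (subst₂ ℤ._≤_ (trans (sym ∥w∥²≡k) (∥∥²≡norm (w x))) (∥∥²≡norm (w x₀))
        (shortest′ (w x₀) (x₀ , λ _ → refl) (nonzero-w⇐v x₀ v₀≢0)))

      N≤N₀ : N x ≤ N₀
      -- The chain is `K² N ≤ ∥ w ∥² + 2 K Q N ≤ ∥ w₀ ∥² + 2 K Q N`, by minimality of `w`, followed
      -- by the upper bound for the image `w₀` of `x₀`.
      N≤N₀ = perturbation-negligible {E = E} {Q} {G} {∣ h x₀ ∣ * ∣ h x₀ ∣} (N x) N₀ 1≤G ≤-refl 7E<K N₀≤G
        (*-mono-≤ ∣h₀∣≤E ∣h₀∣≤E)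
        (≤-trans (w-lower x) (+-monoˡ-≤ _ (≤-trans norm-w≤ (w-upper x₀))))
        where
        ∣h₀∣≤E : ∣ h x₀ ∣ ≤ E
        ∣h₀∣≤E = ≤-trans (∣h∣≤ x₀) (*-monoʳ-≤ Q N₀≤G)

      N≤G : N x ≤ G
      N≤G = ≤-trans N≤N₀ N₀≤G

      k₀≡∥v∥² : k₀ ≡ ∥ v x ∥²
      k₀≡∥v∥² = trans k₀≡N₀ (trans (cong +_ (≤-antisym N₀≤N N≤N₀)) (sym (∥∥²≡norm (v x))))

      QN≤E : Q * N x ≤ E
      QN≤E = *-monoʳ-≤ Q N≤G

      ∣h∣≤E : ∣ h x ∣ ≤ E
      ∣h∣≤E = ≤-trans (∣h∣≤ x) QN≤E

      k≡ : k ≡ + (r * r) ℤ.+ (+ K ℤ.* + N x ℤ.+ (a x ℤ.+ a x)) ℤ.* + K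
      k≡ = trans (sym ∥w∥²≡k) (trans (∥w∥²≡ x) (trans
        (cong (λ y → + K ℤ.* + K ℤ.* + N x ℤ.+ (+ K ℤ.* a x ℤ.+ + K ℤ.* a x) ℤ.+ y)
          (trans (cong₂ ℤ._*_ h≡r h≡r) (sym (ℤ.pos-* r r))))
        (collect (+ K) (+ N x) (a x) (+ (r * r)))))
        where
        collect : ∀ k n a c → k ℤ.* k ℤ.* n ℤ.+ (k ℤ.* a ℤ.+ k ℤ.* a) ℤ.+ c ≡
                  c ℤ.+ (k ℤ.* n ℤ.+ (a ℤ.+ a)) ℤ.* k
        collect = ℤSolver.solve-∀

      ∣k∣≤ : ∣ k ∣ ≤ 3 * (K * K * G)
      -- Main term, cross term and square are each at most `K * K * G`, whence the factor 3.
      ∣k∣≤ = begin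
        ∣ k ∣
          ≡⟨ cong ∣_∣ (trans (sym ∥w∥²≡k) (∥∥²≡norm (w x))) ⟩
        norm (w x)
          ≤⟨ w-upper x ⟩
        K * K * N x + (K * (Q * N x) + K * (Q * N x)) + ∣ h x ∣ * ∣ h x ∣
          ≤⟨ +-mono-≤ (+-mono-≤ (*-monoʳ-≤ (K * K) N≤G)
               (≤-trans (+-mono-≤ (*-monoʳ-≤ K QN≤E) (*-monoʳ-≤ K QN≤E))
                 (≤-trans (≤-reflexive (sym (*-distribˡ-+ K E E)))
                   (≤-trans (*-monoʳ-≤ K (≤-trans (+-monoʳ-≤ E (m≤m+n E (5 * E))) (<⇒≤ 7E<K))) K²≤K²G))))
               (≤-trans (*-mono-≤ ∣h∣≤E ∣h∣≤E) (≤-trans (<⇒≤ E²<K) (≤-trans K≤K² K²≤K²G))) ⟩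
        K * K * G + K * K * G + K * K * G
          ≡⟨ triple (K * K * G) ⟩
        3 * (K * K * G) ∎
        where
        triple : ∀ y → y + y + y ≡ 3 * y
        triple = ℕSolver.solve-∀

        K≤K² : K ≤ K * K
        K≤K² = subst (_≤ K * K) (*-identityʳ K) (*-monoʳ-≤ K 1≤K)

        K²≤K²G : K * K ≤ K * K * G
        K²≤K²G = subst (_≤ K * K * G) (*-identityʳ (K * K)) (*-monoʳ-≤ (K * K) 1≤G)

-- The reduction as a program

infixl 8 _⊠_ _⊘_
infixl 7 _⊞_ _⊟_

_⊞_ _⊟_ _⊠_ _⊘_ : Expr → Expr → Expr
_⊞_ = bin add
_⊟_ = bin sub
_⊠_ = bin mul
_⊘_ = bin div

pattern one = con (+ 1)

pattern #n = 0
pattern #i = 1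
pattern #U = 2
pattern #G = 3
pattern #D = 4
pattern #Q = 5
pattern #K = 6
pattern #k = 7
pattern #r = 8
pattern #p = 9
pattern #h = 10

pattern #B   = 0
pattern #out = 1
pattern #row = 2

boundEntries computePower perturbBasis squareRoot extractDigits : Program

boundEntries =
  while⁺ var #i loop
    (#i ≔ var #i ⊟ one ⨾
     #U ≔ var #U ⊞ get #B (var #i) ⊠ get #B (var #i))

computePower =
  while⁺ var #i loop
    (#i ≔ var #i ⊟ one ⨾
     #Q ≔ var #Q ⊠ var #D)

-- The entry below flat position `i` is at `i + n`, so a descending loop evaluates ℓ up every column
-- by Horner's rule, reading 0 past the end. Positions below `n` form row 0, where the value is
-- complete. Each entry of `B` is overwritten only after its last use.
perturbBasis =
  while⁺ var #i loop
    (#i ≔ var #i ⊟ one ⨾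
     #row [ var #i ]≔ get #B (var #i) ⊞ var #D ⊠ get #row (var #i ⊞ var #n) ⨾
     (if⁺ var #n ⊟ var #i
      then #B [ var #i ]≔ var #K ⊠ get #B (var #i) ⊞ get #row (var #i)
      else (#B [ var #i ]≔ var #K ⊠ get #B (var #i))))

-- Bisection: the root stays in `[r, r + p)`. The `one` in the inner guard turns the test
-- `(r + h)² ≤ k` into strict positivity.
squareRoot =
  while⁺ var #p ⊟ one loop
    (#h ≔ var #p ⊘ con (+ 2) ⨾
     (if⁺ var #k ⊞ one ⊟ (var #r ⊞ var #h) ⊠ (var #r ⊞ var #h)
      then #r ≔ var #r ⊞ var #h ⨾ #p ≔ var #p ⊟ var #h
      else (#p ≔ var #h)))

-- Adding `G` before dividing moves the digits from `-G, …, G` to `0, …, D - 1`, so rounding down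
-- leaves the value of the higher digits, also for negative `r`.
extractDigits =
  while⁺ var #n ⊟ var #i loop
    (#k ≔ (var #r ⊞ var #G) ⊘ var #D ⨾
     #out [ var #i ]≔ var #r ⊟ var #k ⊠ var #D ⨾
     #r ≔ var #k ⨾
     #i ≔ var #i ⊞ one)

boundInput chooseScales perturbInput prepareQuery : Program

boundInput =
  #i ≔ var #n ⊠ var #n ⨾
  #U ≔ var #n ⨾
  boundEntries

chooseScales =
  #G ≔ var #U ⊠ var #U ⊠ var #U ⨾
  #D ≔ var #G ⊞ var #G ⊞ one ⨾
  #Q ≔ one ⨾
  #i ≔ var #n ⨾
  computePower

perturbInput =
  #K ≔ con (+ 8) ⊠ (var #Q ⊠ var #G ⊠ (var #Q ⊠ var #G)) ⨾
  #i ≔ var #n ⊠ var #n ⨾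
  perturbBasis

prepareQuery = boundInput ⨾ chooseScales ⨾ perturbInput

decodeAnswer : Program
decodeAnswer =
  #k ≔ var #k ⊟ var #K ⊠ (var #k ⊘ var #K) ⨾
  #r ≔ con (+ 0) ⨾
  #p ≔ var #k ⊞ one ⨾
  squareRoot ⨾
  #i ≔ con (+ 0) ⨾
  extractDigits

searchSVP : Program
searchSVP = prepareQuery ⨾ #k ≔query #B ⨾ decodeAnswer

-- Loop invariants of the stages

update-same : ∀ {A : Set} (f : ℤ → A) i z → update ℤ._≟_ f i z i ≡ z
update-same f i z with i ℤ.≟ i
... | yes _  = refl
... | no i≢i = contradiction refl i≢i

update-other : ∀ {A : Set} (f : ℤ → A) {i j} z → j ≢ i → update ℤ._≟_ f i z j ≡ f j
update-other f {i} {j} z j≢i with j ℤ.≟ i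
... | yes j≡i = contradiction j≡i j≢i
... | no _    = refl

m<n⇒0<n-m : ∀ {m n} → m < n → 0ℤ ℤ.< + n ℤ.- + m
m<n⇒0<n-m {m} {n} m<n = subst (0ℤ ℤ.<_)
  (trans (sym (ℤ.⊖-≥ (<⇒≤ m<n))) (sym (ℤ.m-n≡m⊖n n m))) (ℤ.+<+ (m<n⇒0<n∸m m<n))

module Stages {n₀} (O : Oracle n₀) {β} (1≤β : 1 ≤ β) where
  open Run O 1≤β public

  -- Stores the result in a chosen form `z` instead of the evaluated expression, so that later
  -- invariants hold by `refl`.
  assign= : ∀ {σ x e} z → Bounded β σ → ⟦ e ⟧ σ ≡ z → ∣ z ∣ ≤ 2 ^ β →
            Runs (x ≔ e) σ (stepTime (x ≔ e)) (setVar σ x z ≡_)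
  assign= {σ} {x} {e} z bd refl z≤ = assign bd z≤

  store= : ∀ {σ a e f} i z → Bounded β σ → ⟦ e ⟧ σ ≡ i → ⟦ f ⟧ σ ≡ z → ∣ z ∣ ≤ 2 ^ β →
           Runs (a [ e ]≔ f) σ (stepTime (a [ e ]≔ f)) (setArr σ a i z ≡_)
  store= {σ} {a} {e} {f} i z bd refl refl z≤ = store bd z≤

  module _ {n Y : ℕ} (Y≤ : Y ≤ 2 ^ β) where

    -- `S` bounds each of the `j` squares still to be added. The a priori bound `Y` on the final sum
    -- thus bounds every partial sum.
    record BoundingEntries (S : ℕ) (as : ℕ → ℤ → ℤ) (j : ℕ) (σ : State) : Set where
      field
        {u}   : ℕ
        n≡    : vars σ #n ≡ + n
        i≡    : vars σ #i ≡ + j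
        u≡    : vars σ #U ≡ + u
        as≡   : arrs σ ≡ as
        n≤u   : n ≤ u
        j≤    : j ≤ n * n
        u≤    : u + j * S ≤ Y
        ∣as∣≤ : ∀ i → j ≤ i → i < n * n → ∣ as #B (+ i) ∣ ≤ u

    boundEntries-runs : ∀ {S as} → n * n ≤ Y →
      (∀ i → ∣ as #B (+ i) ∣ * ∣ as #B (+ i) ∣ ≤ S) →
      ∀ {σ} → Bounded β σ → BoundingEntries S as (n * n) σ →
      Runs boundEntries σ (suc (n * n) * stepTime boundEntries) (BoundingEntries S as 0)
    boundEntries-runs {S} {as} n²≤Y as²≤S = countdown (BoundingEntries S as) BoundingEntries.i≡ step (n * n)
      where
      step : ∀ {j σ} → Bounded β σ → BoundingEntries S as (suc j) σ → Runs _ σ _ (BoundingEntries S as j)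
      step {j} {σ} bd inv =
        assign= (+ j) bd (cong (ℤ._- 1ℤ) i≡) (≤-trans (<⇒≤ j≤) (≤-trans n²≤Y Y≤)) andThen λ where
          bd refl → weaken (assign= (+ (u + x * x)) bd value (≤-trans (≤-trans (m≤m+n _ (j * S)) u′≤) Y≤)) λ where
            refl → record
              { n≡ = n≡ ; i≡ = refl ; u≡ = refl ; as≡ = as≡
              ; n≤u = ≤-trans n≤u (m≤m+n u (x * x)) ; j≤ = <⇒≤ j≤ ; u≤ = u′≤ ; ∣as∣≤ = bound }
        where
        open BoundingEntries inv
        x = ∣ as #B (+ j) ∣

        value : vars σ #U ℤ.+ arrs σ #B (+ j) ℤ.* arrs σ #B (+ j) ≡ + (u + x * x)
        value = cong₂ ℤ._+_ u≡ (trans (cong (λ f → f #B (+ j) ℤ.* f #B (+ j)) as≡) (square≡ (as #B (+ j))))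

        u′≤ : u + x * x + j * S ≤ Y
        u′≤ = ≤-trans (≤-reflexive (+-assoc u (x * x) (j * S)))
          (≤-trans (+-monoʳ-≤ u (+-monoˡ-≤ (j * S) (as²≤S j))) u≤)

        bound : ∀ i → j ≤ i → i < n * n → ∣ as #B (+ i) ∣ ≤ u + x * x
        bound i j≤i i<n² with m≤n⇒m<n∨m≡n j≤i
        ... | inj₁ j<i  = ≤-trans (∣as∣≤ i j<i i<n²) (m≤m+n u (x * x))
        ... | inj₂ refl = ≤-trans (m≤m*m x) (m≤n+m (x * x) u)

    -- Keeping the final power `Q` in the invariant bounds all intermediate ones, since `D ^ j` is
    -- at least 1.
    record ComputingPower (G D Q : ℕ) (as : ℕ → ℤ → ℤ) (j : ℕ) (σ : State) : Set where
      field
        {q} : ℕ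
        n≡  : vars σ #n ≡ + n
        i≡  : vars σ #i ≡ + j
        G≡  : vars σ #G ≡ + G
        D≡  : vars σ #D ≡ + D
        q≡  : vars σ #Q ≡ + q
        as≡ : arrs σ ≡ as
        Q≡  : q * D ^ j ≡ Q

    computePower-runs : ∀ {G D Q as} → n ≤ 2 ^ β → 1 ≤ D → Q ≤ 2 ^ β →
      ∀ j → j ≤ n → ∀ {σ} → Bounded β σ → ComputingPower G D Q as j σ →
      Runs computePower σ (suc j * stepTime computePower) (ComputingPower G D Q as 0)
    computePower-runs {G} {D} {Q} {as} n≤ 1≤D Q≤ j j≤n bd inv = weaken
      (countdown (λ j σ → j ≤ n × ComputingPower G D Q as j σ) (ComputingPower.i≡ ∘ proj₂) step j bd (j≤n , inv))
      proj₂
      where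
      step : ∀ {j σ} → Bounded β σ → suc j ≤ n × ComputingPower G D Q as (suc j) σ →
             Runs _ σ _ (λ σ′ → j ≤ n × ComputingPower G D Q as j σ′)
      step {j} {σ} bd (j<n , inv) =
        assign= (+ j) bd (cong (ℤ._- 1ℤ) i≡) (≤-trans (<⇒≤ j<n) n≤) andThen λ where
          bd refl → weaken
            (assign= (+ (q * D)) bd (trans (cong₂ ℤ._*_ q≡ D≡) (sym (ℤ.pos-* q D))) (≤-trans qD≤Q Q≤)) λ where
              refl → <⇒≤ j<n , record
                { n≡ = n≡ ; i≡ = refl ; G≡ = G≡ ; D≡ = D≡ ; q≡ = refl ; as≡ = as≡ ; Q≡ = qD≡ }
        where
        open ComputingPower inv

        qD≡ : q * D * D ^ j ≡ Q
        qD≡ = trans (*-assoc q D (D ^ j)) Q≡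

        qD≤Q : q * D ≤ Q
        qD≤Q = ≤-trans (m≤m*n (q * D) (D ^ j) {{m^n≢0 D j {{>-nonZero 1≤D}}}}) (≤-reflexive qD≡)

  module _ (n D : ℕ) (b : ℕ → ℤ) where

    -- `suffix m (n * i + j)` is the base `D` value of the entries `i`, …, `i + m ∸ 1` of
    -- column `j` of the row-major matrix `b`.
    suffix : ℕ → ℕ → ℤ
    suffix zero    s = 0ℤ
    suffix (suc m) s = b s ℤ.+ + D ℤ.* suffix m (s + n)

    suffix-beyond : (∀ s → n * n ≤ s → b s ≡ 0ℤ) → ∀ m s → n * n ≤ s → suffix m s ≡ 0ℤ
    suffix-beyond b≡0 zero    s n²≤s = refl
    suffix-beyond b≡0 (suc m) s n²≤s = cong₂ ℤ._+_ (b≡0 s n²≤s)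
      (trans (cong (+ D ℤ.*_) (suffix-beyond b≡0 m (s + n) (≤-trans n²≤s (m≤m+n s n)))) (ℤ.*-zeroʳ (+ D)))

    ∣suffix∣≤ : ∀ {U} → (∀ s → ∣ b s ∣ ≤ U) → ∀ m s → ∣ suffix m s ∣ ≤ U * repunit D m
    ∣suffix∣≤ b≤ zero    s = z≤n
    ∣suffix∣≤ {U} b≤ (suc m) s = begin
      ∣ b s ℤ.+ + D ℤ.* t ∣       ≤⟨ ℤ.∣i+j∣≤∣i∣+∣j∣ (b s) (+ D ℤ.* t) ⟩
      ∣ b s ∣ + ∣ + D ℤ.* t ∣     ≡⟨ cong (λ y → ∣ b s ∣ + y) (ℤ.∣i*j∣≡∣i∣*∣j∣ (+ D) t) ⟩
      ∣ b s ∣ + D * ∣ t ∣         ≤⟨ +-mono-≤ (b≤ s) (*-monoʳ-≤ D (∣suffix∣≤ b≤ m (s + n))) ⟩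
      U + D * (U * repunit D m)   ≡⟨ rearrange U D (repunit D m) ⟩
      U * (1 + D * repunit D m)   ∎
      where
      t = suffix m (s + n)
      rearrange : ∀ a d r → a + d * (a * r) ≡ a * (1 + d * r)
      rearrange = ℕSolver.solve-∀

    suffix≡horner : ∀ m s → suffix m s ≡ horner D {m} (λ i → b (n * toℕ i + s))
    suffix≡horner zero    s = refl
    suffix≡horner (suc m) s = cong₂ (λ x y → x ℤ.+ + D ℤ.* y)
      (cong (λ y → b (y + s)) (sym (*-zeroʳ n)))
      (trans (suffix≡horner m (s + n)) (horner-cong D {m} λ i → cong b (shift n (toℕ i) s)))
      where
      shift : ∀ n i s → n * i + (s + n) ≡ n * suc i + s
      shift = ℕSolver.solve-∀

    module _ (U K G : ℕ) where

      -- In `rows`, `m` is any number of rows that leads from `s` past the end of the matrix, as the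
      -- surplus entries are 0. Thus `suffix n` serves at every position, and the row containing `s`
      -- need not be computed.
      record PerturbingBasis (j : ℕ) (σ : State) : Set where
        field
          n≡    : vars σ #n ≡ + n
          i≡    : vars σ #i ≡ + j
          G≡    : vars σ #G ≡ + G
          D≡    : vars σ #D ≡ + D
          K≡    : vars σ #K ≡ + K
          j≤    : j ≤ n * n
          todo  : ∀ i → i < j → arrs σ #B (+ i) ≡ b i
          rows  : ∀ m s → j ≤ s → n * n ≤ s + m * n → arrs σ #row (+ s) ≡ suffix m s
          first : ∀ i → j ≤ i → i < n → arrs σ #B (+ i) ≡ + K ℤ.* b i ℤ.+ suffix n i
          other : ∀ i → j ≤ i → n ≤ i → i < n * n → arrs σ #B (+ i) ≡ + K ℤ.* b i

      perturbBasis-runs : 1 ≤ n → n * n ≤ 2 ^ β → (∀ s → ∣ b s ∣ ≤ U) → K * U + U * repunit D n ≤ 2 ^ β →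
        ∀ {σ} → Bounded β σ → PerturbingBasis (n * n) σ →
        Runs perturbBasis σ (suc (n * n) * stepTime perturbBasis) (PerturbingBasis 0)
      perturbBasis-runs 1≤n n²≤ b≤ KU+UR≤ = countdown PerturbingBasis PerturbingBasis.i≡ step (n * n)
        where
        step : ∀ {j σ} → Bounded β σ → PerturbingBasis (suc j) σ → Runs _ σ _ (PerturbingBasis j)
        step {j} {σ} bd inv =
          assign= (+ j) bd (cong (ℤ._- 1ℤ) i≡) (≤-trans (<⇒≤ j≤) n²≤) andThen λ where
            bd refl → store= (+ j) z bd refl z≡ (≤-trans ∣z∣≤ (≤-trans (m≤n+m _ (K * U)) KU+UR≤)) andThen λ where
              bd refl → branch bd (finish bd)
          where
          open PerturbingBasis inv

          z : ℤ
          z = suffix n j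

          row[j+n]≡ : ∀ m → n * n ≤ j + suc m * n → arrs σ #row (+ j ℤ.+ vars σ #n) ≡ suffix m (j + n)
          row[j+n]≡ m n²≤ = trans (cong (λ y → arrs σ #row (+ j ℤ.+ y)) n≡)
            (rows m (j + n) (≤-trans (≤-reflexive (+-comm 1 j)) (+-monoʳ-≤ j 1≤n))
              (≤-trans n²≤ (≤-reflexive (sym (+-assoc j n (m * n))))))

          value≡ : ∀ m → n * n ≤ j + m * n →
            arrs σ #B (+ j) ℤ.+ vars σ #D ℤ.* arrs σ #row (+ j ℤ.+ vars σ #n) ≡ suffix m j
          value≡ zero    n²≤ = contradiction (≤-trans n²≤ (≤-reflexive (+-identityʳ j))) (<⇒≱ j≤)
          value≡ (suc m) n²≤ = cong₂ ℤ._+_ (todo j (n<1+n j)) (cong₂ ℤ._*_ D≡ (row[j+n]≡ m n²≤))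

          z≡ : arrs σ #B (+ j) ℤ.+ vars σ #D ℤ.* arrs σ #row (+ j ℤ.+ vars σ #n) ≡ z
          z≡ = value≡ n (m≤n+m (n * n) j)

          ∣z∣≤ : ∣ z ∣ ≤ U * repunit D n
          ∣z∣≤ = ∣suffix∣≤ b≤ n j

          ∣Kb∣≤ : ∣ + K ℤ.* b j ∣ ≤ K * U
          ∣Kb∣≤ = ≤-trans (≤-reflexive (ℤ.∣i*j∣≡∣i∣*∣j∣ (+ K) (b j))) (*-monoʳ-≤ K (b≤ j))

          Kb≡ : vars σ #K ℤ.* arrs σ #B (+ j) ≡ + K ℤ.* b j
          Kb≡ = cong₂ ℤ._*_ K≡ (todo j (n<1+n j))

          τ : State
          τ = setArr (setVar σ #i (+ j)) #row (+ j) z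

          row-same : arrs τ #row (+ j) ≡ z
          row-same = update-same (arrs σ #row) (+ j) z

          invariant : ∀ y → (j < n → y ≡ + K ℤ.* b j ℤ.+ suffix n j) → (n ≤ j → y ≡ + K ℤ.* b j) →
                      PerturbingBasis j (setArr τ #B (+ j) y)
          invariant y y-first y-other = record
            { n≡ = n≡ ; i≡ = refl ; G≡ = G≡ ; D≡ = D≡ ; K≡ = K≡ ; j≤ = <⇒≤ j≤
            ; todo  = λ i i<j → trans (B-other (<⇒≢ i<j)) (todo i (m<n⇒m<1+n i<j))
            ; rows  = rows′ ; first = first′ ; other = other′ }
            where
            B-other : ∀ {i} → i ≢ j → update ℤ._≟_ (arrs σ #B) (+ j) y (+ i) ≡ arrs σ #B (+ i)
            B-other i≢j = update-other (arrs σ #B) y (i≢j ∘ ℤ.+-injective)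

            B-same : update ℤ._≟_ (arrs σ #B) (+ j) y (+ j) ≡ y
            B-same = update-same (arrs σ #B) (+ j) y

            rows′ : ∀ m s → j ≤ s → n * n ≤ s + m * n → arrs τ #row (+ s) ≡ suffix m s
            rows′ m s j≤s n²≤ with m≤n⇒m<n∨m≡n j≤s
            ... | inj₁ j<s  = trans (update-other (arrs σ #row) z (<⇒≢ j<s ∘ sym ∘ ℤ.+-injective)) (rows m s j<s n²≤)
            ... | inj₂ refl = trans row-same (trans (sym z≡) (value≡ m n²≤))

            first′ : ∀ i → j ≤ i → i < n → update ℤ._≟_ (arrs σ #B) (+ j) y (+ i) ≡ + K ℤ.* b i ℤ.+ suffix n i
            first′ i j≤i i<n with m≤n⇒m<n∨m≡n j≤i
            ... | inj₁ j<i  = trans (B-other (<⇒≢ j<i ∘ sym)) (first i j<i i<n)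
            ... | inj₂ refl = trans B-same (y-first i<n)

            other′ : ∀ i → j ≤ i → n ≤ i → i < n * n → update ℤ._≟_ (arrs σ #B) (+ j) y (+ i) ≡ + K ℤ.* b i
            other′ i j≤i n≤i i<n² with m≤n⇒m<n∨m≡n j≤i
            ... | inj₁ j<i  = trans (B-other (<⇒≢ j<i ∘ sym)) (other i j<i n≤i i<n²)
            ... | inj₂ refl = trans B-same (y-other n≤i)

          guard≡ : vars σ #n ℤ.- + j ≡ + n ℤ.- + j
          guard≡ = cong (ℤ._- + j) n≡

          finish : Bounded β τ → (0ℤ ℤ.< vars σ #n ℤ.- + j × Runs _ τ _ (PerturbingBasis j)) ⊎
                                 (vars σ #n ℤ.- + j ℤ.≤ 0ℤ × Runs _ τ _ (PerturbingBasis j))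
          finish bd with j <? n
          ... | yes j<n = inj₁ (subst (0ℤ ℤ.<_) (sym guard≡) (m<n⇒0<n-m j<n) ,
            weaken (store= (+ j) (+ K ℤ.* b j ℤ.+ z) bd refl (cong₂ ℤ._+_ Kb≡ row-same)
              (≤-trans (ℤ.∣i+j∣≤∣i∣+∣j∣ (+ K ℤ.* b j) z) (≤-trans (+-mono-≤ ∣Kb∣≤ ∣z∣≤) KU+UR≤)))
              λ where refl → invariant _ (λ _ → refl) (λ n≤j → contradiction n≤j (<⇒≱ j<n)))
          ... | no j≮n = inj₂ (subst (ℤ._≤ 0ℤ) (sym guard≡) (ℤ.i≤j⇒i-j≤0 (ℤ.+≤+ (≮⇒≥ j≮n))) ,
            weaken (store= (+ j) (+ K ℤ.* b j) bd refl Kb≡ (≤-trans ∣Kb∣≤ (≤-trans (m≤m+n (K * U) _) KU+UR≤)))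
              λ where refl → invariant _ (λ j<n → contradiction j<n j≮n) (λ _ → refl))

  module _ (n G D ρ : ℕ) where

    -- The index bounds the logarithm of the interval length. It starts at `β`, so the number of
    -- rounds is linear in the bit length.
    record Bisecting (j : ℕ) (σ : State) : Set where
      field
        {lo p} : ℕ
        n≡     : vars σ #n ≡ + n
        G≡     : vars σ #G ≡ + G
        D≡     : vars σ #D ≡ + D
        k≡     : vars σ #k ≡ + (ρ * ρ)
        r≡     : vars σ #r ≡ + lo
        p≡     : vars σ #p ≡ + p
        lo≤    : lo ≤ ρ
        <lo+p  : ρ < lo + p
        p≤     : p ≤ 2 ^ j

    record RootFound (σ : State) : Set where
      field
        n≡ : vars σ #n ≡ + n
        G≡ : vars σ #G ≡ + G
        D≡ : vars σ #D ≡ + D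
        r≡ : vars σ #r ≡ + ρ

    squareRoot-runs : ρ ≤ 2 ^ β → ∀ {σ} → Bounded β σ → Bisecting β σ →
                      Runs squareRoot σ (suc β * stepTime squareRoot) RootFound
    squareRoot-runs ρ≤ bd inv = weaken
      (iterate (λ j σ → 2 ^ j ≤ 2 ^ β × Bisecting j σ) step β bd (≤-refl , inv)) finish
      where
      finish : ∀ {σ} → vars σ #p ℤ.- 1ℤ ℤ.≤ 0ℤ × ∃[ j ] (2 ^ j ≤ 2 ^ β × Bisecting j σ) → RootFound σ
      finish {σ} (guard≤0 , j , _ , inv) = record { n≡ = n≡ ; G≡ = G≡ ; D≡ = D≡ ; r≡ = trans r≡ (cong +_ lo≡ρ) }
        where
        open Bisecting inv
        p≤1 : p ≤ 1
        p≤1 = ℤ.drop‿+≤+ (ℤ.i-j≤0⇒i≤j (subst (λ y → y ℤ.- 1ℤ ℤ.≤ 0ℤ) p≡ guard≤0))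
        lo≡ρ : lo ≡ ρ
        lo≡ρ = ≤-antisym lo≤ (s≤s⁻¹ (≤-trans <lo+p
          (≤-trans (+-monoʳ-≤ lo p≤1) (≤-reflexive (+-comm lo 1)))))

      halve : ∀ {j σ} → Bounded β σ → 2 ^ suc j ≤ 2 ^ β → Bisecting (suc j) σ →
              Runs _ σ _ (λ σ′ → 2 ^ j ≤ 2 ^ β × Bisecting j σ′)
      halve {j} {σ} bd 2^j≤ inv =
        assign= (+ h) bd (trans (cong (_÷ (+ 2)) p≡) (ℤ.div-pos-is-/ℕ (+ p) 2)) h≤ andThen λ where
          bd refl → branch bd (choose bd)
        where
        open Bisecting inv
        h = p / 2
        -- `g` is half of `p` rounded up, the length left after removing `h`. It stays within
        -- `2 ^ j` because `p` is at most the even number `2 ^ suc j`.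
        g = p % 2 + h

        p≡g+h : p ≡ g + h
        p≡g+h = trans (m≡m%n+[m/n]*n p 2) (rearrange (p % 2) h)
          where
          rearrange : ∀ e h → e + h * 2 ≡ e + h + h
          rearrange = ℕSolver.solve-∀

        2^j≤′ : 2 ^ j ≤ 2 ^ β
        2^j≤′ = ≤-trans (m≤m+n (2 ^ j) _) 2^j≤

        p≤2^j*2 : p ≤ 2 ^ j * 2
        p≤2^j*2 = ≤-trans p≤ (≤-reflexive (*-comm 2 (2 ^ j)))

        h≤2^j : h ≤ 2 ^ j
        h≤2^j = *-cancelʳ-≤ h (2 ^ j) 2 (≤-trans (m≤n+m (h * 2) (p % 2))
          (≤-trans (≤-reflexive (sym (m≡m%n+[m/n]*n p 2))) p≤2^j*2))

        h≤ : h ≤ 2 ^ β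
        h≤ = ≤-trans h≤2^j 2^j≤′

        g≤2^j : g ≤ 2 ^ j
        g≤2^j = s≤s⁻¹ (*-cancelʳ-< 2 g (suc (2 ^ j)) (begin-strict
          g * 2               ≡⟨ rearrange (p % 2) h ⟩
          p % 2 + (g + h)     ≡⟨ cong (λ y → p % 2 + y) p≡g+h ⟨
          p % 2 + p           <⟨ +-mono-<-≤ (m%n<n p 2) p≤2^j*2 ⟩
          suc (2 ^ j) * 2     ∎))
          where
          rearrange : ∀ e h → (e + h) * 2 ≡ e + (e + h + h)
          rearrange = ℕSolver.solve-∀

        τ : State
        τ = setVar σ #h (+ h)

        lo+h≡ : vars σ #r ℤ.+ + h ≡ + (lo + h)
        lo+h≡ = cong (ℤ._+ + h) r≡

        guard≡ : vars σ #k ℤ.+ 1ℤ ℤ.- (vars σ #r ℤ.+ + h) ℤ.* (vars σ #r ℤ.+ + h) ≡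
                 + suc (ρ * ρ) ℤ.- + ((lo + h) * (lo + h))
        guard≡ = cong₂ ℤ._-_ (trans (cong (ℤ._+ 1ℤ) k≡) (cong +_ (+-comm (ρ * ρ) 1)))
          (trans (cong₂ ℤ._*_ lo+h≡ lo+h≡) (sym (ℤ.pos-* (lo + h) (lo + h))))

        p-h≡g : vars σ #p ℤ.- + h ≡ + g
        p-h≡g = trans (cong (ℤ._- + h) (trans p≡ (cong +_ p≡g+h)))
          (trans (ℤ.m-n≡m⊖n (g + h) h) (trans (ℤ.⊖-≥ (m≤n+m h g)) (cong +_ (m+n∸n≡m g h))))

        choose : Bounded β τ →
          (0ℤ ℤ.< ⟦ var #k ⊞ one ⊟ (var #r ⊞ var #h) ⊠ (var #r ⊞ var #h) ⟧ τ × Runs _ τ _ _) ⊎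
          (⟦ var #k ⊞ one ⊟ (var #r ⊞ var #h) ⊠ (var #r ⊞ var #h) ⟧ τ ℤ.≤ 0ℤ × Runs _ τ _ _)
        choose bd with lo + h ≤? ρ
        ... | yes lo+h≤ρ = inj₁
          ( subst (0ℤ ℤ.<_) (sym guard≡) (m<n⇒0<n-m (s≤s (*-mono-≤ lo+h≤ρ lo+h≤ρ)))
          , (assign= (+ (lo + h)) bd lo+h≡ (≤-trans lo+h≤ρ ρ≤) andThen λ where
              bd refl → weaken (assign= (+ g) bd p-h≡g (≤-trans g≤2^j 2^j≤′)) λ where
                refl → 2^j≤′ , record
                  { n≡ = n≡ ; G≡ = G≡ ; D≡ = D≡ ; k≡ = k≡ ; r≡ = refl ; p≡ = refl
                  ; lo≤ = lo+h≤ρ ; p≤ = g≤2^j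
                  ; <lo+p = ≤-trans <lo+p (≤-reflexive (trans (cong (λ y → lo + y) (trans p≡g+h (+-comm g h)))
                      (sym (+-assoc lo h g)))) }) )
        ... | no lo+h≰ρ = inj₂
          ( subst (ℤ._≤ 0ℤ) (sym guard≡) (ℤ.i≤j⇒i-j≤0 (ℤ.+≤+ (*-mono-< (≰⇒> lo+h≰ρ) (≰⇒> lo+h≰ρ))))
          , weaken (assign= (+ h) bd refl h≤) λ where
              refl → 2^j≤′ , record
                { n≡ = n≡ ; G≡ = G≡ ; D≡ = D≡ ; k≡ = k≡ ; r≡ = r≡ ; p≡ = refl
                ; lo≤ = lo≤ ; <lo+p = ≰⇒> lo+h≰ρ ; p≤ = h≤2^j } )

      step : ∀ {j σ} → Bounded β σ → 2 ^ j ≤ 2 ^ β × Bisecting j σ →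
             vars σ #p ℤ.- 1ℤ ℤ.≤ 0ℤ ⊎
             (0ℤ ℤ.< vars σ #p ℤ.- 1ℤ × ∃[ i ] (j ≡ suc i × Runs _ σ _ (λ σ′ → 2 ^ i ≤ 2 ^ β × Bisecting i σ′)))
      step {j} {σ} bd (2^j≤ , inv) with Bisecting.p inv ≤? 1
      ... | yes p≤1 = inj₁ (subst (λ y → y ℤ.- 1ℤ ℤ.≤ 0ℤ) (sym (Bisecting.p≡ inv)) (ℤ.i≤j⇒i-j≤0 (ℤ.+≤+ p≤1)))
      step {zero}  bd (2^j≤ , inv) | no p≰1 = contradiction (Bisecting.p≤ inv) p≰1
      step {suc j} {σ} bd (2^j≤ , inv) | no p≰1 = inj₂
        ( subst (λ y → 0ℤ ℤ.< y ℤ.- 1ℤ) (sym (Bisecting.p≡ inv)) (m<n⇒0<n-m (≰⇒> p≰1))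
        , j , refl , halve bd 2^j≤ inv )

  module _ {n G D : ℕ} (D≡G+G+1 : D ≡ G + G + 1) (v : Vector ℤ n) where

    -- `rest` consists of the last `j` coordinates of `v`; relating indices through `toℕ` avoids a
    -- cast along `i + j ≡ n`.
    record ExtractingDigits (j : ℕ) (σ : State) : Set where
      field
        {i}     : ℕ
        {rest}  : Vector ℤ j
        i+j≡n   : i + j ≡ n
        n≡      : vars σ #n ≡ + n
        G≡      : vars σ #G ≡ + G
        D≡      : vars σ #D ≡ + D
        i≡      : vars σ #i ≡ + i
        r≡      : vars σ #r ≡ horner D rest
        ∣rest∣≤ : ∀ t → ∣ rest t ∣ ≤ G
        rest≡   : ∀ q t → toℕ q ≡ i + toℕ t → v q ≡ rest t
        out≡    : ∀ q → toℕ q < i → arrs σ #out (+ toℕ q) ≡ v q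

    extractDigits-runs : n ≤ 2 ^ β → G ≤ 2 ^ β → (∀ j → j ≤ n → G * repunit D j ≤ 2 ^ β) →
      ∀ {σ} → Bounded β σ → ExtractingDigits n σ →
      Runs extractDigits σ (suc n * stepTime extractDigits) (ExtractingDigits 0)
    extractDigits-runs n≤ G≤ GR≤ = countdown ExtractingDigits guard step n
      where
      guard : ∀ {j σ} → ExtractingDigits j σ → vars σ #n ℤ.- vars σ #i ≡ + j
      guard {j} inv = trans (cong₂ ℤ._-_ (trans n≡ (cong +_ (sym i+j≡n))) i≡)
        (trans (ℤ.m-n≡m⊖n (i + j) i) (trans (ℤ.⊖-≥ (m≤m+n i j)) (cong +_ (m+n∸m≡n i j))))
        where open ExtractingDigits inv

      step : ∀ {j σ} → Bounded β σ → ExtractingDigits (suc j) σ → Runs _ σ _ (ExtractingDigits j)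
      step {j} {σ} bd inv =
        assign= t bd quotient≡ ∣t∣≤ andThen λ where
          bd refl → store= (+ i) d bd i≡ digit≡ (≤-trans (∣rest∣≤ zero) G≤) andThen λ where
            bd refl → assign= t bd refl ∣t∣≤ andThen λ where
              bd refl → weaken (assign= (+ suc i) bd i+1≡ (≤-trans i<n n≤)) λ where
                refl → record
                  { i+j≡n = trans (sym (+-suc i j)) i+j≡n ; n≡ = n≡ ; G≡ = G≡ ; D≡ = D≡
                  ; i≡ = refl ; r≡ = refl ; ∣rest∣≤ = ∣rest∣≤ ∘ suc
                  ; rest≡ = λ q s q≡ → rest≡ q (suc s) (trans q≡ (sym (+-suc i (toℕ s))))
                  ; out≡ = out≡′ }
        where
        open ExtractingDigits inv
        d t : ℤ
        d = rest zero
        t = horner D (rest ∘ suc)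

        i<n : i < n
        i<n = ≤-trans (m≤m+n (suc i) j) (≤-reflexive (trans (sym (+-suc i j)) i+j≡n))

        ∣t∣≤ : ∣ t ∣ ≤ 2 ^ β
        ∣t∣≤ = ≤-trans (∣horner∣≤ D (rest ∘ suc) (∣rest∣≤ ∘ suc))
          (GR≤ j (≤-trans (m≤n+m j (suc i)) (≤-reflexive (trans (sym (+-suc i j)) i+j≡n))))

        quotient≡ : (vars σ #r ℤ.+ vars σ #G) ÷ vars σ #D ≡ t
        quotient≡ with c , d+G≡c ← nonneg-shift d (∣rest∣≤ zero) =
          trans (cong₂ _÷_ (trans (cong₂ ℤ._+_ r≡ G≡) (trans (rearrange d (+ D) t (+ G))
            (cong (ℤ._+ t ℤ.* + D) d+G≡c))) D≡) (÷-unique t c<D)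
          where
          rearrange : ∀ d b t g → d ℤ.+ b ℤ.* t ℤ.+ g ≡ d ℤ.+ g ℤ.+ t ℤ.* b
          rearrange = ℤSolver.solve-∀
          c<D : c < D
          c<D = begin-strict
            c                  ≡⟨ cong ∣_∣ d+G≡c ⟨
            ∣ d ℤ.+ + G ∣      ≤⟨ ℤ.∣i+j∣≤∣i∣+∣j∣ d (+ G) ⟩
            ∣ d ∣ + G          ≤⟨ +-monoˡ-≤ G (∣rest∣≤ zero) ⟩
            G + G              <⟨ m<m+n (G + G) (s≤s z≤n) ⟩
            G + G + 1          ≡⟨ D≡G+G+1 ⟨
            D                  ∎

        digit≡ : vars σ #r ℤ.- t ℤ.* vars σ #D ≡ d
        digit≡ = trans (cong₂ (λ y z → y ℤ.- t ℤ.* z) r≡ D≡) (cancel d (+ D) t)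
          where
          cancel : ∀ d b t → d ℤ.+ b ℤ.* t ℤ.- t ℤ.* b ≡ d
          cancel = ℤSolver.solve-∀

        i+1≡ : vars σ #i ℤ.+ 1ℤ ≡ + suc i
        i+1≡ = trans (cong (ℤ._+ 1ℤ) i≡) (cong +_ (+-comm i 1))

        out≡′ : ∀ q → toℕ q < suc i → update ℤ._≟_ (arrs σ #out) (+ i) d (+ toℕ q) ≡ v q
        out≡′ q q<1+i with m≤n⇒m<n∨m≡n (s≤s⁻¹ q<1+i)
        ... | inj₁ q<i = trans (update-other (arrs σ #out) d (<⇒≢ q<i ∘ ℤ.+-injective)) (out≡ q q<i)
        ... | inj₂ q≡i = trans (cong (λ y → update ℤ._≟_ (arrs σ #out) (+ i) d (+ y)) q≡i)
          (trans (update-same (arrs σ #out) (+ i) d)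
            (sym (rest≡ q zero (trans q≡i (sym (+-identityʳ i))))))

-- `iterations` bounds the number of iterations of every outermost loop.
runTime : (iterations : ℕ) → Program → ℕ
runTime N (P ⨾ Q)           = runTime N P + runTime N Q
runTime N (while⁺ e loop P) = suc N * stepTime (while⁺ e loop P)
runTime N P                 = stepTime P

runTimePolynomial : ∀ {k} → Polynomial k → Program → Polynomial k
runTimePolynomial N (P ⨾ Q)           = runTimePolynomial N P ⊕ runTimePolynomial N Q
runTimePolynomial N (while⁺ e loop P) = (const 1 ⊕ N) ⊗ const (stepTime (while⁺ e loop P))
runTimePolynomial N P                 = const (stepTime P)

eval-runTime : ∀ {k} N (ρ : Vector ℕ k) P → eval (runTimePolynomial N P) ρ ≡ runTime (eval N ρ) P
eval-runTime N ρ (P ⨾ Q)                = cong₂ _+_ (eval-runTime N ρ P) (eval-runTime N ρ Q)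
eval-runTime N ρ (while⁺ e loop P)      = refl
eval-runTime N ρ skip                   = refl
eval-runTime N ρ (x ≔ e)                = refl
eval-runTime N ρ (a [ e ]≔ f)           = refl
eval-runTime N ρ (if⁺ e then P else Q)  = refl
eval-runTime N ρ (x ≔query a)           = refl

timePolynomial : ∀ {k} → Polynomial k → Polynomial k → Program → Polynomial k
timePolynomial N β P = runTimePolynomial N P ⊗ ((const 1 ⊕ β) ⊗ (const 1 ⊕ β))

eval-timePolynomial : ∀ {k} N β (ρ : Vector ℕ k) P →
  eval (timePolynomial N β P) ρ ≡ runTime (eval N ρ) P * unit (eval β ρ)
eval-timePolynomial N β ρ P = cong (_* unit (eval β ρ)) (eval-runTime N ρ P)

SolvedWithin : ∀ {n} → Oracle n → Matrix n → ℕ → Set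
SolvedWithin {n} O B T =
  ∃[ σ ] ∃[ t ] ∃[ B′ ]
    (O ⊢ searchSVP , initial B ⇓ σ ∣ t ∣ (B′ ∷ []))
    × Nonsingular B′
    × output {n} σ ∈L B
    × Isλ₁² B ∥ output {n} σ ∥²
    × t ≤ T

-- The input matrix in the store

≤-foldr-⊔ : ∀ {n} (f : Vector ℕ n) i → f i ≤ Vector.foldr _⊔_ 0 f
≤-foldr-⊔ f zero    = m≤m⊔n _ _
≤-foldr-⊔ f (suc i) = ≤-trans (≤-foldr-⊔ (f ∘ suc) i) (m≤n⊔m _ _)

∣entry∣≤maxAbs : ∀ {n} (B : Matrix n) i j → ∣ B i j ∣ ≤ maxAbs B
∣entry∣≤maxAbs B i j = ≤-trans (≤-foldr-⊔ (λ k → ∣ B i k ∣) j)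
  (≤-foldr-⊔ (λ k → Vector.foldr _⊔_ 0 λ l → ∣ B k l ∣) i)

module Input {n} (B : Matrix n) where

  entry : ℕ → ℤ
  entry s = arrs (initial B) #B (+ s)

  entry-combine : ∀ i j → entry (n * toℕ i + toℕ j) ≡ B i j
  entry-combine i j with n * toℕ i + toℕ j <? n * n
  ... | no s≮n² = contradiction (subst (_< n * n) (Fin.toℕ-combine i j) (Fin.toℕ<n (combine i j))) s≮n²
  ... | yes s<n² = trans
    (cong (Vector.concat B) (trans (Fin.fromℕ<-cong _ _ (sym (Fin.toℕ-combine i j)) s<n² (Fin.toℕ<n (combine i j)))
      (Fin.fromℕ<-toℕ (combine i j) (Fin.toℕ<n (combine i j)))))
    (cong (λ where (k , l) → B k l) (Fin.remQuot-combine i j))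

  entry-beyond : ∀ s → n * n ≤ s → entry s ≡ 0ℤ
  entry-beyond s n²≤s with s <? n * n
  ... | yes s<n² = contradiction n²≤s (<⇒≱ s<n²)
  ... | no _     = refl

  ∣entry∣≤ : ∀ {M} → (∀ i j → ∣ B i j ∣ ≤ M) → ∀ s → ∣ entry s ∣ ≤ M
  ∣entry∣≤ B≤ s with s <? n * n
  ... | yes s<n² = B≤ _ _
  ... | no _     = z≤n

-- The complete run

-- `N` majorizes the rounds of every outermost loop: `β` for bisection, at most `n²` for the others.
-- The polynomials behind `β` and `N` enter only at the end.
module Reduction {m} (O : Oracle (suc m)) (B : Matrix (suc m)) (M : ℕ)
  (B≤M : ∀ i j → ∣ B i j ∣ ≤ M) {β N} (1≤β : 1 ≤ β) (β≤N : β ≤ N) (n²≤N : suc m * suc m ≤ N) where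

  open Stages O 1≤β
  open Input B

  n S Y : ℕ
  n = suc m
  -- The successor keeps `S` positive, which gives `n * n ≤ Y`, and `suc M` is still at most
  -- `2 ^ suc ⌊log₂ M ⌋`.
  S = suc M * suc M
  Y = n + n * n * S

  n²≤Y : n * n ≤ Y
  n²≤Y = ≤-trans (m≤m*n (n * n) S) (m≤n+m (n * n * S) n)

  within : ∀ {e P σ j Φ} → j ≤ N →
           Runs (while⁺ e loop P) σ (suc j * stepTime (while⁺ e loop P)) Φ →
           Runs (while⁺ e loop P) σ (runTime N (while⁺ e loop P)) Φ
  within {e} {P} j≤N (runs ex t≤ bd φ) =
    runs ex (≤-trans t≤ (*-monoˡ-≤ (unit β) (*-monoˡ-≤ (stepTime (while⁺ e loop P)) (s≤s j≤N)))) bd φ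

  n≤N : n ≤ N
  n≤N = ≤-trans (m≤m*m n) n²≤N

  record QueryReady (σ : State) : Set where
    field
      {U}    : ℕ
      scales : Scales U n
      n≤U    : n ≤ U
      B≤U    : ∀ i j → ∣ B i j ∣ ≤ U
      U≤Y    : U ≤ Y
    open Scales scales public
    field
      n≡     : vars σ #n ≡ + n
      G≡v    : vars σ #G ≡ + G
      D≡v    : vars σ #D ≡ + D
      K≡v    : vars σ #K ≡ + K
      first  : ∀ j → readMatrix {n} σ #B zero j ≡ + K ℤ.* B zero j ℤ.+ horner D λ i → B i j
      others : ∀ i j → readMatrix {n} σ #B (suc i) j ≡ + K ℤ.* B (suc i) j

  -- The bound on the answer, `3 K² G`, dominates all scales and all perturbed entries, so one
  -- inequality suffices for them. It is required for every `U ≤ Y` because `U` is known only from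
  -- the run.
  module Sizes (Y≤ : Y ≤ 2 ^ β)
    (fits : ∀ {U} (s : Scales U n) → U ≤ Y → 3 * (Scales.K s * Scales.K s * Scales.G s) ≤ 2 ^ β) where

    module Fits {U} (s : Scales U n) (1≤U : 1 ≤ U) (U≤Y : U ≤ Y) where
      open Scales s
      open ScaleBounds s 1≤U public

      K≤K²G : K ≤ K * K * G
      K≤K²G = ≤-trans (m≤m*m K) (m≤m*n (K * K) G {{>-nonZero 1≤G}})

      K²G+K²G≤ : K * K * G + K * K * G ≤ 2 ^ β
      K²G+K²G≤ = ≤-trans (+-monoʳ-≤ (K * K * G) (m≤m+n (K * K * G) (K * K * G + 0))) (fits s U≤Y)

      K≤ : K ≤ 2 ^ β
      K≤ = ≤-trans K≤K²G (≤-trans (m≤m+n (K * K * G) (K * K * G)) K²G+K²G≤)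

      E≤ : E ≤ 2 ^ β
      E≤ = ≤-trans E≤K K≤

      G≤ : G ≤ 2 ^ β
      G≤ = ≤-trans G≤E E≤

      Q≤ : Q ≤ 2 ^ β
      Q≤ = ≤-trans Q≤E E≤

      D≤ : D ≤ 2 ^ β
      D≤ = begin
        D               ≡⟨ D≡ ⟩
        G + G + 1       ≤⟨ +-mono-≤ (+-mono-≤ G≤E G≤E) 1≤E ⟩
        E + E + E       ≤⟨ m≤m+n (E + E + E) (4 * E) ⟩
        E + E + E + 4 * E ≡⟨ collect E ⟩
        7 * E           ≤⟨ <⇒≤ 7E<K ⟩
        K               ≤⟨ K≤ ⟩
        2 ^ β           ∎
        where
        collect : ∀ e → e + e + e + 4 * e ≡ 7 * e
        collect = ℕSolver.solve-∀

      U≤G : U ≤ G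
      U≤G = ≤-trans U≤U² U²≤G

      KU+UR≤ : K * U + U * repunit D n ≤ 2 ^ β
      KU+UR≤ = ≤-trans (+-mono-≤
          (≤-trans (*-monoʳ-≤ K U≤G) (*-monoˡ-≤ G (m≤m*m K)))
          (≤-trans (*-mono-≤ U≤G repunit≤Q) (≤-trans (≤-reflexive (*-comm G Q)) (≤-trans E≤K K≤K²G))))
        K²G+K²G≤

    ready : ∀ {U} (s : Scales U n) → n ≤ U → U ≤ Y → (∀ i j → ∣ B i j ∣ ≤ U) → let open Scales s in
            ∀ {σ} → PerturbingBasis n D entry U K G 0 σ → QueryReady σ
    ready {U} s n≤U U≤Y B≤U {σ} inv = record
      { scales = s ; n≤U = n≤U ; B≤U = B≤U ; U≤Y = U≤Y
      ; n≡ = P.n≡ ; G≡v = P.G≡ ; D≡v = P.D≡ ; K≡v = P.K≡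
      ; first = first ; others = others }
      where
      open Scales s
      module P = PerturbingBasis inv

      matrix≡ : ∀ i j → readMatrix {n} σ #B i j ≡ arrs σ #B (+ (n * toℕ i + toℕ j))
      matrix≡ i j = cong (λ s → arrs σ #B (+ s)) (Fin.toℕ-combine i j)

      row-zero : ∀ (j : Fin n) → n * 0 + toℕ j ≡ toℕ j
      row-zero j = cong (_+ toℕ j) (*-zeroʳ n)

      first : ∀ j → readMatrix {n} σ #B zero j ≡ + K ℤ.* B zero j ℤ.+ horner D λ i → B i j
      first j = trans (matrix≡ zero j) (trans
        (P.first (n * 0 + toℕ j) z≤n (subst (_< n) (sym (row-zero j)) (Fin.toℕ<n j)))
        (cong₂ (λ x y → + K ℤ.* x ℤ.+ y) (entry-combine zero j)
          (trans (cong (suffix n D entry n) (row-zero j))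
            (trans (suffix≡horner n D entry n (toℕ j)) (horner-cong D {n} λ i → entry-combine i j)))))

      others : ∀ i j → readMatrix {n} σ #B (suc i) j ≡ + K ℤ.* B (suc i) j
      others i j = trans (matrix≡ (suc i) j) (trans
        (P.other (n * toℕ (suc i) + toℕ j) z≤n
          (≤-trans (m≤m*n n (suc (toℕ i))) (m≤m+n (n * suc (toℕ i)) (toℕ j)))
          (subst (_< n * n) (Fin.toℕ-combine (suc i) j) (Fin.toℕ<n (combine (suc i) j))))
        (cong (+ K ℤ.*_) (entry-combine (suc i) j)))

    n≤ : n ≤ 2 ^ β
    n≤ = ≤-trans (m≤m+n n (n * n * S)) Y≤

    n²≤ : n * n ≤ 2 ^ β
    n²≤ = ≤-trans n²≤Y Y≤

    perturbInput-runs : ∀ {U} (s : Scales U n) → 1 ≤ U → U ≤ Y → (∀ t → ∣ entry t ∣ ≤ U) → let open Scales s in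
      ∀ {σ} → Bounded β σ → ComputingPower {n} {Y} Y≤ G D Q (arrs (initial B)) 0 σ →
      Runs perturbInput σ (runTime N perturbInput) (PerturbingBasis n D entry U K G 0)
    perturbInput-runs {U} s 1≤U U≤Y entry≤ {σ} bd inv =
      assign= (+ K) bd K≡v K≤ andThen λ where
        bd refl → assign= (+ (n * n)) bd (trans (cong₂ ℤ._*_ C.n≡ C.n≡) (sym (ℤ.pos-* n n))) n²≤ andThen λ where
          bd refl → within n²≤N (perturbBasis-runs n D entry U K G (s≤s z≤n) n²≤ entry≤ KU+UR≤ bd record
            { n≡ = C.n≡ ; i≡ = refl ; G≡ = C.G≡ ; D≡ = C.D≡ ; K≡ = refl ; j≤ = ≤-refl
            ; todo  = λ i _ → cong (λ f → f #B (+ i)) C.as≡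
            ; rows  = λ t s n²≤s _ → trans (cong (λ f → f #row (+ s)) C.as≡)
                (sym (suffix-beyond n D entry entry-beyond t s n²≤s))
            ; first = λ i n²≤i i<n → contradiction (≤-trans (m≤m*m n) n²≤i) (<⇒≱ i<n)
            ; other = λ i n²≤i _ i<n² → contradiction n²≤i (<⇒≱ i<n²) })
      where
      open Scales s
      open Fits s 1≤U U≤Y
      module C = ComputingPower inv

      QG≡ : vars σ #Q ℤ.* vars σ #G ≡ + (Q * G)
      QG≡ = trans (cong₂ ℤ._*_ (trans C.q≡ (cong +_ (trans (sym (*-identityʳ C.q)) C.Q≡))) C.G≡)
        (sym (ℤ.pos-* Q G))

      K≡v : + 8 ℤ.* (vars σ #Q ℤ.* vars σ #G ℤ.* (vars σ #Q ℤ.* vars σ #G)) ≡ + K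
      K≡v = trans (cong (λ y → + 8 ℤ.* (y ℤ.* y)) QG≡)
        (trans (cong (λ y → + 8 ℤ.* y) (sym (ℤ.pos-* (Q * G) (Q * G))))
          (trans (sym (ℤ.pos-* 8 (Q * G * (Q * G)))) (cong +_ (sym K≡))))

    chooseScales-runs : ∀ {U} → 1 ≤ U → U ≤ Y → ∀ {σ} → Bounded β σ →
      BoundingEntries {n} {Y} Y≤ S (arrs (initial B)) 0 σ → vars σ #U ≡ + U →
      Runs chooseScales σ (runTime N chooseScales)
        (λ σ′ → Σ[ s ∈ Scales U n ] let open Scales s in
          ComputingPower {n} {Y} Y≤ G D Q (arrs (initial B)) 0 σ′)
    chooseScales-runs {U} 1≤U U≤Y {σ} bd inv U≡ =
      assign= (+ G) bd UUU≡ G≤ andThen λ where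
        bd refl → assign= (+ D) bd refl D≤ andThen λ where
          bd refl → assign= (+ 1) bd refl (≤-trans 1≤Q Q≤) andThen λ where
            bd refl → assign= (+ n) bd P.n≡ n≤ andThen λ where
              bd refl → within n≤N (weaken (computePower-runs Y≤ n≤ (≤-trans (s≤s z≤n) 2≤D) Q≤ n ≤-refl bd record
                { n≡ = P.n≡ ; i≡ = refl ; G≡ = refl ; D≡ = refl ; q≡ = refl ; as≡ = P.as≡
                ; Q≡ = *-identityˡ Q }) (s ,_))
      where
      s : Scales U n
      s = record { G≡ = refl ; D≡ = refl ; Q≡ = refl ; K≡ = refl }
      open Scales s using (G; D; Q)
      open Fits s 1≤U U≤Y
      module P = BoundingEntries inv

      UUU≡ : vars σ #U ℤ.* vars σ #U ℤ.* vars σ #U ≡ + G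
      UUU≡ = trans (cong (λ y → y ℤ.* y ℤ.* y) U≡)
        (trans (cong (ℤ._* + U) (sym (ℤ.pos-* U U))) (sym (ℤ.pos-* (U * U) U)))

    boundInput-runs : ∀ {σ} → Bounded β σ → vars σ #n ≡ + n → arrs σ ≡ arrs (initial B) →
      Runs boundInput σ (runTime N boundInput) (BoundingEntries {n} {Y} Y≤ S (arrs (initial B)) 0)
    boundInput-runs {σ} bd n≡ as≡ =
      assign= (+ (n * n)) bd (trans (cong₂ ℤ._*_ n≡ n≡) (sym (ℤ.pos-* n n))) n²≤ andThen λ where
        bd refl → assign= (+ n) bd n≡ n≤ andThen λ where
          bd refl → within n²≤N (boundEntries-runs Y≤ n²≤Y
            (λ i → *-mono-≤ (≤-trans (∣entry∣≤ B≤M i) (n≤1+n M)) (≤-trans (∣entry∣≤ B≤M i) (n≤1+n M)))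
            bd record
              { n≡ = n≡ ; i≡ = refl ; u≡ = refl ; as≡ = as≡ ; n≤u = ≤-refl ; j≤ = ≤-refl ; u≤ = ≤-refl
              ; ∣as∣≤ = λ i n²≤i i<n² → contradiction n²≤i (<⇒≱ i<n²) })

    prepareQuery-runs : ∀ {σ} → Bounded β σ → vars σ #n ≡ + n → arrs σ ≡ arrs (initial B) →
      Runs prepareQuery σ (runTime N prepareQuery) QueryReady
    prepareQuery-runs bd n≡ as≡ =
      boundInput-runs bd n≡ as≡ andThen λ bd inv →
        let open BoundingEntries inv renaming (u to U; n≤u to n≤U)
            1≤U = ≤-trans (s≤s z≤n) n≤U
            U≤Y = ≤-trans (≤-reflexive (sym (+-identityʳ U))) u≤
            entry≤ = bounded-entry λ i i<n² → ∣as∣≤ i z≤n i<n²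
            B≤U = λ i j → subst (λ y → ∣ y ∣ ≤ U) (entry-combine i j) (entry≤ (n * toℕ i + toℕ j))
        in chooseScales-runs 1≤U U≤Y bd inv u≡ andThen λ where
          bd (s , inv) → weaken (perturbInput-runs s 1≤U U≤Y entry≤ bd inv) (ready s n≤U U≤Y B≤U)
      where
      bounded-entry : ∀ {U} → (∀ s → s < n * n → ∣ entry s ∣ ≤ U) → ∀ s → ∣ entry s ∣ ≤ U
      bounded-entry {U} entry≤ s = by-cases (s <? n * n)
        where
        by-cases : Dec (s < n * n) → ∣ entry s ∣ ≤ U
        by-cases (yes s<n²) = entry≤ s s<n²
        by-cases (no s≮n²)  = subst (λ y → ∣ y ∣ ≤ U) (sym (entry-beyond s (≮⇒≥ s≮n²))) z≤n

    decodeAnswer-runs : ∀ {U} (s : Scales U n) → 1 ≤ U → U ≤ Y → let open Scales s in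
      ∀ {σ v ρ} q → Bounded β σ → vars σ #n ≡ + n → vars σ #G ≡ + G → vars σ #D ≡ + D → vars σ #K ≡ + K →
      vars σ #k ≡ + (ρ * ρ) ℤ.+ q ℤ.* + K → ρ ≤ Q * G → horner D v ≡ + ρ → (∀ i → ∣ v i ∣ ≤ G) →
      Runs decodeAnswer σ (runTime N decodeAnswer) (λ σ′ → ∀ i → output {n} σ′ i ≡ v i)
    decodeAnswer-runs {U} s 1≤U U≤Y {σ} {v} {ρ} q bd n≡ G≡v D≡v K≡v k≡ ρ≤E horner≡ ∣v∣≤G =
      assign= (+ (ρ * ρ)) bd remainder≡ (≤-trans (n≤1+n (ρ * ρ)) ρ²<2^β) andThen λ where
        bd refl → assign= (+ 0) bd refl z≤n andThen λ where
          bd refl → assign= (+ suc (ρ * ρ)) bd (cong +_ (+-comm (ρ * ρ) 1)) ρ²<2^β andThen λ where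
            bd refl → within β≤N (squareRoot-runs n G D ρ (≤-trans ρ≤E E≤) bd record
                { n≡ = n≡ ; G≡ = G≡v ; D≡ = D≡v ; k≡ = refl ; r≡ = refl ; p≡ = refl
                ; lo≤ = z≤n ; <lo+p = s≤s (m≤m*m ρ) ; p≤ = ρ²<2^β }) andThen λ bd found →
              let module R = RootFound found in
              assign= (+ 0) bd refl z≤n andThen λ where
                bd refl → within n≤N (weaken (extractDigits-runs D≡ v n≤ G≤ GR≤ bd record
                  { i+j≡n = refl ; n≡ = R.n≡ ; G≡ = R.G≡ ; D≡ = R.D≡ ; i≡ = refl
                  ; r≡ = trans R.r≡ (sym horner≡) ; ∣rest∣≤ = ∣v∣≤G
                  ; rest≡ = λ i t i≡t → cong v (Fin.toℕ-injective i≡t)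
                  ; out≡ = λ _ () }) extracted)
      where
      open Scales s
      open Fits s 1≤U U≤Y

      ρ²<K : ρ * ρ < K
      ρ²<K = ≤-<-trans (*-mono-≤ ρ≤E ρ≤E) E²<K

      ρ²<2^β : ρ * ρ < 2 ^ β
      ρ²<2^β = ≤-trans ρ²<K K≤

      remainder≡ : vars σ #k ℤ.- vars σ #K ℤ.* (vars σ #k ÷ vars σ #K) ≡ + (ρ * ρ)
      remainder≡ = trans (cong₂ (λ k K → k ℤ.- K ℤ.* (k ÷ K)) k≡ K≡v)
        (trans (cong (λ y → + (ρ * ρ) ℤ.+ q ℤ.* + K ℤ.- + K ℤ.* y) (÷-unique q ρ²<K))
          (cancel (+ (ρ * ρ)) q (+ K)))
        where
        cancel : ∀ r q k → r ℤ.+ q ℤ.* k ℤ.- k ℤ.* q ≡ r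
        cancel = ℤSolver.solve-∀

      GR≤ : ∀ j → j ≤ n → G * repunit D j ≤ 2 ^ β
      GR≤ j j≤n = begin
        G * repunit D j    ≤⟨ *-monoʳ-≤ G (<⇒≤ (repunit<D^ D 2≤D j)) ⟩
        G * D ^ j          ≤⟨ *-monoʳ-≤ G (^-monoʳ-≤ D {{>-nonZero (≤-trans (s≤s z≤n) 2≤D)}} j≤n) ⟩
        G * D ^ n          ≡⟨ cong (λ y → G * y) Q≡ ⟨
        G * Q              ≡⟨ *-comm G Q ⟩
        E                  ≤⟨ E≤ ⟩
        2 ^ β              ∎

      extracted : ∀ {σ′} → ExtractingDigits {n} {G} {D} D≡ v 0 σ′ → ∀ i → output {n} σ′ i ≡ v i
      extracted inv t = out≡ t (≤-trans (Fin.toℕ<n t) (≤-reflexive (sym (trans (sym (+-identityʳ _)) i+j≡n))))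
        where open ExtractingDigits inv

    conclude : ∀ {σ₁ t₁ v} → O ⊢ prepareQuery , initial B ⇓ σ₁ ∣ t₁ ∣ [] →
      t₁ ≤ runTime N prepareQuery * unit β → Nonsingular (readMatrix {n} σ₁ #B) →
      v ∈L B → Isλ₁² B ∥ v ∥² →
      Runs decodeAnswer (setVar σ₁ #k (O (readMatrix σ₁ #B))) (runTime N decodeAnswer)
        (λ σ′ → ∀ i → output {n} σ′ i ≡ v i) →
      SolvedWithin O B (runTime N searchSVP * unit β)
    conclude {σ₁} {t₁} prepare t₁≤ nonsingular (x , v≡) shortest (runs {σ₂} {t₂} decode t₂≤ _ out≡) =
      σ₂ , t₁ + (1 + t₂) , readMatrix σ₁ #B , seq⇓ prepare (seq⇓ query⇓ decode) , nonsingular ,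
      (x , λ i → trans (out≡ i) (v≡ i)) ,
      subst (Isλ₁² B) (sum-cong-≗ λ i → sym (cong₂ ℤ._*_ (out≡ i) (out≡ i))) shortest ,
      total (runTime N prepareQuery) (runTime N decodeAnswer) t₁≤ t₂≤
      where
      total : ∀ T₁ T₂ {t₁ t₂} → t₁ ≤ T₁ * unit β → t₂ ≤ T₂ * unit β →
              t₁ + (1 + t₂) ≤ (T₁ + (1 + T₂)) * unit β
      total T₁ T₂ t₁≤ t₂≤ = ≤-trans (+-mono-≤ t₁≤ (suc≤ T₂ t₂≤))
        (≤-reflexive (sym (*-distribʳ-+ (unit β) T₁ (suc T₂))))

    solved : Nonsingular B → OptimizationSVP O → Bounded β (initial B) →
             SolvedWithin O B (runTime N searchSVP * unit β)
    solved det≢0 optimal bd₀ = query (prepareQuery-runs bd₀ refl refl)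
      where
      query : Runs prepareQuery (initial B) (runTime N prepareQuery) QueryReady →
              SolvedWithin O B (runTime N searchSVP * unit β)
      query (runs {final = σ₁} prepare t₁≤ bd₁ ready) =
        conclude prepare t₁≤ nonsingular′ D.∈lattice D.shortest
          (decodeAnswer-runs scales (≤-trans (s≤s z≤n) n≤U) U≤Y D.quotient bd₂
            n≡ G≡v D≡v K≡v D.k≡ D.root≤E D.horner≡ D.∣vector∣≤)
        where
        open QueryReady ready
        module P = Perturbation B det≢0 n≤U B≤U scales

        B′ : Matrix n
        B′ = readMatrix σ₁ #B

        nonsingular′ : Nonsingular B′
        nonsingular′ = P.perturbed-nonsingular {B′} first others

        decoding : P.Decoding {B′} first others (O B′)
        -- The guarantee of the oracle at `B` itself is used only to know that `L(B)` has a shortest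
        -- vector; the program never submits `B`.
        decoding = P.decode {B′} first others (optimal B det≢0) (optimal B′ nonsingular′)

        module D = P.Decoding decoding

        bd₂ : Bounded β (setVar σ₁ #k (O B′))
        bd₂ = setVar-bounded {z = O B′} #k bd₁ (≤-trans D.∣k∣≤ (fits scales U≤Y))

-- Polynomial bounds

pattern logM = X zero
pattern dim  = X (suc zero)
pattern logn = X (suc (suc zero))

private
  -- `2 ^` the value of such a polynomial bounds the corresponding scale.
  uBits gBits dBits eBits kBits βBits iterations timeBound : Polynomial 3
  uBits      = const 1 ⊕ (((const 1 ⊕ logn) ⊕ (const 1 ⊕ logn)) ⊕ ((const 1 ⊕ logM) ⊕ (const 1 ⊕ logM)))
  gBits      = (uBits ⊕ uBits) ⊕ uBits
  dBits      = const 2 ⊕ gBits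
  eBits      = (dBits ⊗ dim) ⊕ gBits
  kBits      = const 3 ⊕ (eBits ⊕ eBits)
  βBits      = const 2 ⊕ ((kBits ⊕ kBits) ⊕ gBits)
  iterations = βBits ⊕ (dim ⊗ dim)
  timeBound  = timePolynomial iterations βBits searchSVP

*-≤2^ : ∀ {a b} p q → a ≤ 2 ^ p → b ≤ 2 ^ q → a * b ≤ 2 ^ (p + q)
*-≤2^ p q a≤ b≤ = ≤-trans (*-mono-≤ a≤ b≤) (≤-reflexive (sym (^-distribˡ-+-* 2 p q)))

module Polynomially {m} (B : Matrix (suc m)) where

  n M : ℕ
  n = suc m
  M = maxAbs B

  ρ : Vector ℕ 3
  ρ = ⌊log₂ M ⌋ Vector.∷ n Vector.∷ ⌊log₂ n ⌋ Vector.∷ Vector.[]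

  S Y : ℕ
  S = suc M * suc M
  Y = n + n * n * S

  Y≤2^u : Y ≤ 2 ^ eval uBits ρ
  Y≤2^u = begin
    n + n * n * S              ≤⟨ +-monoˡ-≤ (n * n * S) (≤-trans (m≤m*m n) (m≤m*n (n * n) S)) ⟩
    n * n * S + n * n * S      ≡⟨ double (n * n * S) ⟩
    2 * (n * n * S)            ≤⟨ *-monoʳ-≤ 2 (*-≤2^ (ln + ln) (lM + lM) (*-≤2^ ln ln n≤ n≤) (*-≤2^ lM lM M≤ M≤)) ⟩
    2 ^ eval uBits ρ           ∎
    where
    ln = suc ⌊log₂ n ⌋
    lM = suc ⌊log₂ M ⌋

    n≤ : n ≤ 2 ^ ln
    n≤ = <⇒≤ (n<2^[1+⌊log₂n⌋] n)

    M≤ : suc M ≤ 2 ^ lM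
    M≤ = n<2^[1+⌊log₂n⌋] M

    double : ∀ y → y + y ≡ 2 * y
    double = ℕSolver.solve-∀

  module _ {U} (s : Scales U n) (U≤Y : U ≤ Y) where
    open Scales s

    G≤2^g : G ≤ 2 ^ eval gBits ρ
    G≤2^g = ≤-trans (≤-reflexive G≡) (*-≤2^ (u + u) u (*-≤2^ u u U≤ U≤) U≤)
      where
      u = eval uBits ρ
      U≤ : U ≤ 2 ^ u
      U≤ = ≤-trans U≤Y Y≤2^u

    D≤2^d : D ≤ 2 ^ eval dBits ρ
    D≤2^d = begin
      D                            ≡⟨ D≡ ⟩
      G + G + 1                    ≤⟨ +-mono-≤ (+-mono-≤ G≤2^g G≤2^g) (m^n>0 2 g) ⟩
      2 ^ g + 2 ^ g + 2 ^ g        ≤⟨ m≤m+n _ (2 ^ g) ⟩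
      2 ^ g + 2 ^ g + 2 ^ g + 2 ^ g ≡⟨ quadruple (2 ^ g) ⟩
      2 ^ (2 + g)                  ∎
      where
      g = eval gBits ρ
      quadruple : ∀ y → y + y + y + y ≡ 2 * (2 * y)
      quadruple = ℕSolver.solve-∀

    -- `Q = D ^ n` multiplies the bit length of `D` by `n`: here `dim`, and not merely `logn`,
    -- enters the size of the numbers.
    E≤2^e : Q * G ≤ 2 ^ eval eBits ρ
    E≤2^e = *-≤2^ (eval dBits ρ * n) (eval gBits ρ)
      (≤-trans (≤-reflexive Q≡) (≤-trans (^-monoˡ-≤ n D≤2^d) (≤-reflexive (^-*-assoc 2 (eval dBits ρ) n))))
      G≤2^g

    K≤2^k : K ≤ 2 ^ eval kBits ρ
    K≤2^k = ≤-trans (≤-reflexive K≡) (*-≤2^ 3 (e + e) ≤-refl (*-≤2^ e e E≤2^e E≤2^e))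
      where e = eval eBits ρ

    3K²G≤2^β : 3 * (K * K * G) ≤ 2 ^ eval βBits ρ
    3K²G≤2^β = *-≤2^ 2 (k + k + eval gBits ρ) (s≤s (s≤s (s≤s z≤n)))
      (*-≤2^ (k + k) (eval gBits ρ) (*-≤2^ k k K≤2^k K≤2^k) G≤2^g)
      where k = eval kBits ρ

  Y≤2^β : Y ≤ 2 ^ eval βBits ρ
  Y≤2^β = ≤-trans Y≤2^u (^-monoʳ-≤ 2 (≤-trans (m≤n+m u (u + u))
    (≤-trans (m≤n+m (eval gBits ρ) (k + k)) (m≤n+m (k + k + eval gBits ρ) 2))))
    where
    u = eval uBits ρ
    k = eval kBits ρ

  initial-bounded : Bounded (eval βBits ρ) (initial B)
  initial-bounded = bounds vars≤ arrs≤
    where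
    vars≤ : ∀ x → ∣ vars (initial B) x ∣ ≤ 2 ^ eval βBits ρ
    vars≤ zero    = ≤-trans (m≤m+n n (n * n * S)) Y≤2^β
    vars≤ (suc x) = z≤n

    M≤Y : M ≤ Y
    M≤Y = ≤-trans (≤-trans (n≤1+n M) (≤-trans (m≤m*m (suc M)) (m≤n*m S (n * n)))) (m≤n+m (n * n * S) n)

    arrs≤ : ∀ a i → ∣ arrs (initial B) a i ∣ ≤ 2 ^ eval βBits ρ
    arrs≤ zero    (+ s)    = ≤-trans (Input.∣entry∣≤ B (∣entry∣≤maxAbs B) s) (≤-trans M≤Y Y≤2^β)
    arrs≤ zero    -[1+ s ] = z≤n
    arrs≤ (suc a) i        = z≤n

mainTheorem6 : Σ[ P ∈ Program ] Σ[ q ∈ Polynomial 3 ]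
    (∀ (n : ℕ) .{{_ : NonZero n}} (O : Oracle n) → OptimizationSVP O →
    ∀ (B : Matrix n) → Nonsingular B →
    ∃[ σ ] ∃[ t ] ∃[ B′ ]
    (O ⊢ P , initial B ⇓ σ ∣ t ∣ (B′ ∷ []))
    × Nonsingular B′
    × output {n} σ ∈L B
    × Isλ₁² B ∥ output {n} σ ∥²
    × t ≤ eval q (⌊log₂ maxAbs B ⌋ Vector.∷ n Vector.∷ ⌊log₂ n ⌋ Vector.∷ Vector.[]))
mainTheorem6 = searchSVP , timeBound , solves
  where
  solves : ∀ (n : ℕ) .{{_ : NonZero n}} (O : Oracle n) → OptimizationSVP O →
    ∀ (B : Matrix n) → Nonsingular B →
    SolvedWithin O B (eval timeBound (⌊log₂ maxAbs B ⌋ Vector.∷ n Vector.∷ ⌊log₂ n ⌋ Vector.∷ Vector.[]))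
  -- Comparing the arguments `ρ` alone avoids an evaluation of `timeBound`.
  solves (suc m) O optimal B det≢0 = subst (λ ρ → SolvedWithin O B (eval timeBound ρ))
    {ρ} {⌊log₂ maxAbs B ⌋ Vector.∷ suc m Vector.∷ ⌊log₂ suc m ⌋ Vector.∷ Vector.[]} refl
    (subst (SolvedWithin O B) (sym (eval-timePolynomial iterations βBits ρ searchSVP))
      (Sizes.solved Y≤2^β 3K²G≤2^β det≢0 optimal initial-bounded))
    where
    open Polynomially B
    open Reduction O B M (∣entry∣≤maxAbs B) {eval βBits ρ} {eval iterations ρ}
      (s≤s z≤n) (m≤m+n (eval βBits ρ) (n * n)) (m≤n+m (n * n) (eval βBits ρ)) using (module Sizes)
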